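{- For all finite subsets $P \subseteq \mathbb{R}^d$, $\operatorname{opx}(n, P, d) = \Theta(\operatorname{ex}(n, M_P, d))$, where the constant in the bound depends on the differences between the consecutive values for each coordinate of $P$.
   Context: Here $d$ is the dimension and $n$ ranges over positive integers (so that $\operatorname{ex}$ is defined). Containment for subsets of $\mathbb{R}^d$: for $P, S \subseteq \mathbb{R}^d$, let $C_i(P)$ and $C_i(S)$ be the sets of all $i$-th coordinates of points of $P$ and $S$. $S$ contains $P$ if there exist functions $f_i : C_i(P) \to C_i(S)$ for $i = 1, \dots, d$ such that (1) for each $i$, $\frac{f_i(x)-f_i(x')}{x-x'} \ge 1$ for all $x > x'$ in $C_i(P)$; (2) $(f_1(x_1), \dots, f_d(x_d)) \in S$ for all $(x_1, \dots, x_d) \in P$. Otherwise $S$ is $P$-free. For real $n > 0$, $\operatorname{opx}(n,P,d)$ is the supremum of the $d$-dimensional Lebesgue measure $\mu_d(S)$ over all open $P$-free subsets $S \subseteq [0,n]^d$. A $d$-dimensional 0-1 matrix $A$ contains a $d$-dimensional 0-1 matrix $B$ if some submatrix of $A$ is either equal to $B$ or can be turned into $B$ by changing some ones to zeroes; otherwise $A$ is $B$-free. $\operatorname{ex}(n, M, d)$ is the maximum possible number of ones in a $d$-dimensional $M$-free 0-1 matrix with all dimensions equal to $n$. For finite $P \subseteq \mathbb{R}^d$, $M_P$ is the $d$-dimensional 0-1 matrix whose $i$-th dimension has length equal to the number of distinct values of the $i$-th coordinate of points of $P$, the indices of the $i$-th dimension corresponding to these values in order, with a one in each entry corresponding to a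 point of $P$ and a zero in each other entry. $f(n) = \Theta(g(n))$ means there are constants $C_1, C_2 > 0$ with $C_1 g(n) \le f(n) \le C_2 g(n)$ for all sufficiently large $n$. -}

module Defs where

open import Level using (0ℓ; _⊔_)
open import Algebra.Bundles using (CommutativeRing)
import Algebra.Definitions.RawMonoid as RawMonoid
open import Axiom.ExcludedMiddle using (ExcludedMiddle)
open import Data.Bool.Base as Bool using (Bool)
open import Data.Fin.Base as Fin using (Fin; toℕ)
open import Data.Fin.Properties using (∀-cons)
open import Data.List.Base using (List; []; _∷_; map; length; lookup; deduplicate; concatMap; allFin; filterᵇ; drop; zipWith)
import Data.List.Membership.Setoid as SetoidMembership
import Data.List.Sort as Sort
open import Data.Nat.Base as ℕ using (ℕ; zero; suc; NonZero)
open import Data.Product using (Σ; ∃; ∃-syntax; _×_; _,_; proj₁; proj₂)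
open import Function.Bundles using (Func; _⇔_; mk⇔)
open import Relation.Binary.Bundles using (Setoid; DecTotalOrder)
import Relation.Binary.Construct.NonStrictToStrict as NonStrictToStrict
import Relation.Binary.Construct.On as On
open import Relation.Binary.Core using (Rel)
open import Relation.Binary.PropositionalEquality as ≡ using (_≡_)
open import Relation.Binary.Structures using (IsTotalOrder)
open import Relation.Nullary using (¬_; yes; no)
open import Relation.Nullary.Decidable using (does; does-⇔)
open import Relation.Unary using (Pred; _∈_; _⊆_)

module Bounds {a ℓ₁} {A : Set a} (_≤_ : Rel A ℓ₁) where

  UpperBound LowerBound : ∀ {ℓ} → Pred A ℓ → Pred A (a ⊔ ℓ₁ ⊔ ℓ)
  UpperBound S u = ∀ {x} → x ∈ S → x ≤ u
  LowerBound S l = ∀ {x} → x ∈ S → l ≤ x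

  IsSup IsInf IsMax : ∀ {ℓ} → Pred A ℓ → Pred A (a ⊔ ℓ₁ ⊔ ℓ)
  IsSup S s = UpperBound S s × LowerBound (UpperBound S) s
  IsInf S s = LowerBound S s × UpperBound (LowerBound S) s
  IsMax S m = m ∈ S × UpperBound S m

-- The real numbers, characterised up to isomorphism as a complete
-- ordered field.  Equality is a setoid equality, since ℝ is a quotient.
record CompleteOrderedField : Set₁ where
  infix  4 _≤_
  infix  8 _⁻¹
  infixl 7 _/_

  field
    commutativeRing : CommutativeRing 0ℓ 0ℓ

  open CommutativeRing commutativeRing public

  field
    _≤_          : Rel Carrier 0ℓ
    isTotalOrder : IsTotalOrder _≈_ _≤_
    +-monoˡ-≤    : ∀ z {x y} → x ≤ y → x + z ≤ y + z
    *-nonNeg     : ∀ {x y} → 0# ≤ x → 0# ≤ y → 0# ≤ x * y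

    0≉1          : ¬ (0# ≈ 1#)
    -- Total for convenience; the value at 0# is unspecified.
    _⁻¹          : Carrier → Carrier
    ⁻¹-cong      : ∀ {x y} → x ≈ y → x ⁻¹ ≈ y ⁻¹
    ⁻¹-inverseʳ  : ∀ {x} → ¬ (x ≈ 0#) → x * x ⁻¹ ≈ 1#

  open Bounds _≤_ public

  field
    complete     : (S : Pred Carrier 0ℓ) → ∃ S → ∃ (UpperBound S) → ∃ (IsSup S)

  open NonStrictToStrict _≈_ _≤_ public using (_<_)
  open RawMonoid +-rawMonoid public using () renaming (_×_ to _·_; sum to ∑)
  open RawMonoid *-rawMonoid public using () renaming (sum to ∏)

  _/_ : Carrier → Carrier → Carrier
  x / y = x * y ⁻¹

  fromℕ : ℕ → Carrier
  fromℕ n = n · 1#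

Index : ∀ {d} → (Fin d → ℕ) → Set
Index n = ∀ i → Fin (n i)

-- Multi-indices are functions, so without function extensionality
-- respecting pointwise equality has to be required.
record Matrix {d} (n : Fin d → ℕ) : Set where
  field
    entry      : Index n → Bool
    entry-cong : ∀ {x y} → (∀ i → x i ≡ y i) → entry x ≡ entry y

open Matrix public

allIndices : ∀ {d} (n : Fin d → ℕ) → List (Index n)
allIndices {zero}  n = (λ ()) ∷ []
allIndices {suc d} n = concatMap (λ j → map (∀-cons j) (allIndices (λ i → n (Fin.suc i)))) (allFin (n Fin.zero))

ones : ∀ {d} {n : Fin d → ℕ} → Matrix n → ℕ
ones {n = n} A = length (filterᵇ (entry A) (allIndices n))

StrictlyIncreasing : ∀ {k m} → (Fin k → Fin m) → Set
StrictlyIncreasing φ = ∀ {i j} → i Fin.< j → φ i Fin.< φ j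

submatrix : ∀ {d} {m n : Fin d → ℕ} → Matrix m → (∀ i → Fin (n i) → Fin (m i)) → Matrix n
submatrix A φ .entry x = entry A (λ i → φ i (x i))
submatrix A φ .entry-cong x≗y = entry-cong A (λ i → ≡.cong (φ i) (x≗y i))

-- B arises from A by changing some (possibly no) ones to zeroes.
_≤ᴹ_ : ∀ {d} {n : Fin d → ℕ} → Matrix n → Matrix n → Set
B ≤ᴹ A = ∀ x → entry B x Bool.≤ entry A x

ContainsMatrix : ∀ {d} {m n : Fin d → ℕ} → Matrix m → Matrix n → Set
ContainsMatrix A B = ∃[ φ ] (∀ i → StrictlyIncreasing (φ i)) × B ≤ᴹ submatrix A φ

MatrixFree : ∀ {d} {m n : Fin d → ℕ} → Matrix n → Matrix m → Set
MatrixFree B A = ¬ ContainsMatrix A B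

module Extremal (lem : ∀ {ℓ} → ExcludedMiddle ℓ) (R : CompleteOrderedField) where

  open CompleteOrderedField R renaming (Carrier to ℝ; setoid to ℝ-setoid)

  -- These agree with the true bounds whenever those exist.  The junk value
  -- 0 is the usual convention for suprema of empty sets of nonnegative
  -- numbers; that case arises only for P = ∅, which every set contains.
  sup inf : ∀ {ℓ} → Pred ℝ ℓ → ℝ
  sup S with lem {P = ∃ (IsSup S)}
  ... | yes (s , _) = s
  ... | no  _       = 0#
  inf S with lem {P = ∃ (IsInf S)}
  ... | yes (s , _) = s
  ... | no  _       = 0#

  max : ∀ {ℓ} → Pred ℕ ℓ → ℕ
  max S with lem {P = ∃ (Bounds.IsMax ℕ._≤_ S)}
  ... | yes (m , _) = m
  ... | no  _       = 0

  Point : ℕ → Set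
  Point d = Fin d → ℝ

  pointSetoid : ℕ → Setoid 0ℓ 0ℓ
  pointSetoid d = record
    { Carrier       = Point d
    ; _≈_           = λ p q → ∀ i → p i ≈ q i
    ; isEquivalence = record
      { refl  = λ _ → refl
      ; sym   = λ p≈q i → sym (p≈q i)
      ; trans = λ p≈q q≈r i → trans (p≈q i) (q≈r i)
      }
    }

  record Subset (d : ℕ) : Set₁ where
    field
      member : Pred (Point d) 0ℓ
      resp   : ∀ {p q} → (∀ i → p i ≈ q i) → p ∈ member → q ∈ member

  open Subset public

  Finite : ∀ {d} → Subset d → Set
  Finite {d} P = ∃[ ps ] ∀ p → p ∈ member P ⇔ p ∈ₗ ps
    where open SetoidMembership (pointSetoid d) renaming (_∈_ to _∈ₗ_)

  IsOpen : ∀ {d} → Subset d → Set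
  IsOpen S = ∀ p → p ∈ member S →
    ∃[ ε ] 0# < ε × (∀ q → (∀ i → p i - ε < q i × q i < p i + ε) → q ∈ member S)

  Cube : ∀ d → ℝ → Pred (Point d) 0ℓ
  Cube d x p = ∀ i → 0# ≤ p i × p i ≤ x

  record Box (d : ℕ) : Set where
    field
      lower upper : Point d
      ordered     : ∀ i → lower i ≤ upper i

    Interior : Pred (Point d) 0ℓ
    Interior p = ∀ i → lower i < p i × p i < upper i

    volume : ℝ
    volume = ∏ (λ i → upper i - lower i)

  open Box public

  -- Only meant for series of nonnegative terms, where the partial sums
  -- increase to the sum.
  IsSum : (ℕ → ℝ) → Pred ℝ 0ℓ
  IsSum a = IsSup (λ x → ∃[ n ] x ≈ ∑ {n} (λ k → a (toℕ k)))

  IsCover : ∀ {d} → Subset d → (ℕ → Box d) → Set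
  IsCover S B = ∀ p → p ∈ member S → ∃[ k ] p ∈ Interior (B k)

  -- Lebesgue outer measure, whose restriction to the measurable sets (in
  -- particular to the open sets, the only ones measured below) is
  -- Lebesgue measure.  Boxes may be degenerate, so for d ≥ 1 finite covers
  -- are included.
  μ : ∀ {d} → Subset d → ℝ
  μ S = inf (λ t → ∃[ B ] IsCover S B × IsSum (λ k → volume (B k)) t)

  Coord : ∀ {d} → Subset d → Fin d → Pred ℝ 0ℓ
  Coord S i x = ∃[ p ] p ∈ member S × p i ≈ x

  CoordSetoid : ∀ {d} → Subset d → Fin d → Setoid 0ℓ 0ℓ
  CoordSetoid S i = On.setoid {B = ∃ (Coord S i)} ℝ-setoid proj₁

  Contains : ∀ {d} → Subset d → Subset d → Set
  Contains S P =
    Σ (∀ i → Func (CoordSetoid P i) (CoordSetoid S i)) λ f →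
      (∀ i (x x′ : ∃ (Coord P i)) → proj₁ x′ < proj₁ x →
        1# ≤ (proj₁ (Func.to (f i) x) - proj₁ (Func.to (f i) x′)) / (proj₁ x - proj₁ x′))
    × (∀ p (p∈P : p ∈ member P) →
        (λ i → proj₁ (Func.to (f i) (p i , p , p∈P , refl))) ∈ member S)

  Free : ∀ {d} → Subset d → Subset d → Set
  Free P S = ¬ Contains S P

  opx : ℝ → ∀ {d} → Subset d → ℝ
  opx x {d} P =
    sup (λ t → ∃[ S ] IsOpen S × member S ⊆ Cube d x × Free P S × t ≈ μ S)

  ex : ℕ → ∀ {d} {m : Fin d → ℕ} → Matrix m → ℕ
  ex n {d} M = max (λ k → ∃[ A ] MatrixFree M A × ones {d} {λ _ → n} A ≡ k)

  ℝ-decTotalOrder : DecTotalOrder 0ℓ 0ℓ 0ℓ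
  ℝ-decTotalOrder = record
    { isDecTotalOrder = record
      { isTotalOrder = isTotalOrder
      ; _≟_          = λ _ _ → lem
      ; _≤?_         = λ _ _ → lem
      }
    }

  open DecTotalOrder ℝ-decTotalOrder using () renaming (_≟_ to _≈?_)
  open Sort ℝ-decTotalOrder using (sort)

  values : ∀ {d} (P : Subset d) → Finite P → Fin d → List ℝ
  values P (ps , _) i = deduplicate _≈?_ (sort (map (λ p → p i) ps))

  M[_,_] : ∀ {d} (P : Subset d) (fin : Finite P) → Matrix (λ i → length (values P fin i))
  M[ P , fin ] .entry x = does (lem {P = (λ i → lookup (values P fin i) (x i)) ∈ member P})
  M[ P , fin ] .entry-cong x≗y = does-⇔
    (mk⇔ (resp P (λ i → reflexive (≡.cong (lookup (values P fin i)) (x≗y i))))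
         (resp P (λ i → reflexive (≡.cong (lookup (values P fin i)) (≡.sym (x≗y i))))))
    lem lem

  gaps : ∀ {d} (P : Subset d) → Finite P → Fin d → List ℝ
  gaps P fin i = zipWith _-_ (drop 1 (values P fin i)) (values P fin i)

  -- f = Θ(g) with the constants exposed, so that what they depend on can
  -- be expressed.
  _≍[_,_]_ : (ℕ → ℝ) → ℝ → ℝ → (ℕ → ℝ) → Set
  f ≍[ C₁ , C₂ ] g =
    ∃[ N ] ∀ n → N ℕ.≤ n → C₁ * g n ≤ f n × f n ≤ C₂ * g n

{-# OPTIONS --safe #-}

module Submission where

open import Defs
open import Level using (0ℓ; Level) renaming (suc to lsuc)
import Algebra.Properties.CommutativeMonoid.Sum as CommutativeMonoidSum
import Algebra.Properties.Monoid.Mult as MonoidMult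
import Algebra.Properties.Monoid.Sum as MonoidSum
import Algebra.Properties.Ring as RingProperties
import Algebra.Properties.Semiring.Mult.TCOptimised as Mult
import Algebra.Solver.Ring as RingSolver
open import Algebra.Solver.Ring.AlmostCommutativeRing using (fromCommutativeRing; _-Raw-AlmostCommutative⟶_)
open import Axiom.ExcludedMiddle using (ExcludedMiddle)
open import Data.Bool.Base as Bool using (Bool; true; false; T; not)
open import Data.Bool.Properties using (T-≡; T?)
open import Data.Empty using (⊥; ⊥-elim)
open import Data.Fin.Base as Fin using (Fin; toℕ)
import Data.Fin.Properties as Fin
open import Data.Integer.Base as ℤ using (ℤ)
import Data.Integer.Properties as ℤ
open import Data.List.Base using (List; []; _∷_; _++_; map; length; lookup; concatMap; allFin; filterᵇ; deduplicate; drop; zipWith)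
open import Data.List.Membership.Propositional using () renaming (_∈_ to _∈ₗ_)
open import Data.List.Membership.Propositional.Properties using (∈-lookup; ∈-map⁺; ∈-concatMap⁺; ∈-filter⁺; ∈-allFin)
open import Data.List.Properties using (map-tabulate; length-filter)
open import Data.List.Relation.Binary.Permutation.Propositional using (↭-sym)
import Data.List.Relation.Binary.Permutation.Propositional.Properties as ↭
open import Data.List.Relation.Binary.Pointwise.Base using (Pointwise; []; _∷_)
open import Data.List.Relation.Unary.All as All using (All; []; _∷_)
import Data.List.Relation.Unary.All.Properties as All
open import Data.List.Relation.Unary.AllPairs as AllPairs using (AllPairs; []; _∷_)
import Data.List.Relation.Unary.AllPairs.Properties as AllPairs
open import Data.List.Relation.Unary.Any as Any using (Any; here; there)
import Data.List.Relation.Unary.Any.Properties as Any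
import Data.List.Relation.Unary.Linked.Properties as Linked
import Data.List.Relation.Unary.Unique.DecSetoid.Properties as Unique
import Data.List.Sort as Sort
open import Data.Maybe.Base as Maybe using (Maybe)
open import Data.Nat.Base as ℕ using (ℕ; zero; suc; z≤n; s≤s; NonZero)
import Data.Nat.Properties as ℕ
open import Data.Product using (∃; ∃-syntax; _×_; _,_; proj₁; proj₂)
open import Data.Sum.Base using (_⊎_; inj₁; inj₂)
open import Data.Unit.Base using (tt)
open import Function.Base using (_∘_)
open import Function.Bundles using (Func; Equivalence; mk⇔)
open import Relation.Binary.Bundles using (TotalOrder; DecTotalOrder)
import Relation.Binary.Construct.NonStrictToStrict as NonStrictToStrict
open import Relation.Binary.Core using (Rel)
open import Relation.Binary.Definitions using (Decidable; Tri)
open import Relation.Binary.PropositionalEquality as ≡ using (_≡_)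
import Relation.Binary.Properties.Poset as PosetProperties
import Relation.Binary.Reasoning.PartialOrder as PartialOrderReasoning
import Relation.Binary.Reasoning.Setoid as SetoidReasoning
open import Relation.Nullary using (¬_; Dec; yes; no; does)
open import Relation.Nullary.Decidable using (dec⇒maybe; dec-true; does-⇔; ¬?)
open import Relation.Unary using (Pred; _⊆_; _∈_)

-- Upper bound: for every t, the points of t + Lℤᵈ lying in a P-free open set
-- S ⊆ [0,n]ᵈ form an M_P-free n × ⋯ × n matrix as soon as L exceeds all gaps of P.
-- So no point of [0,L]ᵈ is covered more than ex(n, M_P) times by the translates of
-- the pieces of S in the cells of side L, and hence μ(S) ≤ Lᵈ ex(n, M_P) up to a
-- constant factor, lost by thickening closed dyadic cubes to open boxes.
--
-- Lower bound: if s is at most 1 and at most every gap of P, the union of the open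
-- cells of side s at the ones of an M_P-free matrix is P-free.  Its outer measure is
-- bounded below on the closed middle halves of the cells, by bisection.

-- `μ` is an infimum over countable covers by boxes, and no additivity is proved for it, so the
-- number of hits cannot simply be integrated over [0,L]ᵈ. The upper bound instead exhibits one
-- cover and controls its total volume by a conserved quantity. While [0,L]ᵈ is bisected, an index
-- whose translate of the current cube lies in S has that translate boxed and is retired there; this
-- lowers by one the number of hits still possible at each point of the cube. That number times the
-- volume of a tripled cube is divided exactly between the boxes issued and the 2ᵈ children, so the
-- total is at most (3L)ᵈ ex(n, M_P).
--
-- The lower bound must handle every countable cover. Compactness reduces each middle half to
-- finitely many boxes, and counting boxes only by their overlaps with the disjoint middle halves
-- prevents double counting. It also borrows from the upper bound: `μ` is a genuine infimum only
-- once some cover has finite total volume.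
--
-- Empty P is treated apart, as nothing is free of it and both functions take default values.

-- Arithmetic and order in a complete ordered field.

module OrderedField (lem : ∀ {ℓ} → ExcludedMiddle ℓ) (R : CompleteOrderedField) where

  open CompleteOrderedField R renaming (Carrier to ℝ; setoid to ℝ-setoid)
  open RingProperties ring using (-0#≈0#; -‿+-comm; -‿distribˡ-*; -‿distribʳ-*; -‿involutive)

  module Solver where
    open import Data.Integer.Base using (+_; -[1+_])
    open Mult semiring using (×1-homo-*; ×-homo-+) renaming (_×_ to _×′_)
    open SetoidReasoning ℝ-setoid

    -- Integer coefficients have a decidable equality that computes, as the solver needs for
    -- collecting terms. The optimised multiple makes `1 ×′ 1#` reduce to `1#`, so that `𝟙` denotes
    -- `1#` itself.
    fromℤ : ℤ → ℝ
    fromℤ (+ n)    = n ×′ 1#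
    fromℤ -[1+ n ] = - (suc n ×′ 1#)

    fromℤ-neg : ∀ n → fromℤ (ℤ.- (+ n)) ≈ - (n ×′ 1#)
    fromℤ-neg zero    = sym -0#≈0#
    fromℤ-neg (suc n) = refl

    cancel-1# : ∀ x y → x - y ≈ (1# + x) - (1# + y)
    cancel-1# x y = sym (begin
      (1# + x) - (1# + y)     ≈⟨ +-congˡ (-‿+-comm 1# y) ⟨
      (1# + x) + (- 1# - y)   ≈⟨ +-congʳ (+-comm 1# x) ⟩
      (x + 1#) + (- 1# - y)   ≈⟨ +-assoc x 1# _ ⟩
      x + (1# + (- 1# - y))   ≈⟨ +-congˡ (+-assoc 1# (- 1#) _) ⟨
      x + ((1# - 1#) - y)     ≈⟨ +-congˡ (+-congʳ (-‿inverseʳ 1#)) ⟩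
      x + (0# - y)            ≈⟨ +-congˡ (+-identityˡ _) ⟩
      x - y                   ∎)

    fromℤ-⊖ : ∀ m n → fromℤ (m ℤ.⊖ n) ≈ m ×′ 1# - n ×′ 1#
    fromℤ-⊖ m       zero    = sym (trans (+-congˡ -0#≈0#) (+-identityʳ _))
    fromℤ-⊖ zero    (suc n) = sym (+-identityˡ _)
    fromℤ-⊖ (suc m) (suc n) = begin
      fromℤ (suc m ℤ.⊖ suc n)            ≡⟨ ≡.cong fromℤ (ℤ.[1+m]⊖[1+n]≡m⊖n m n) ⟩
      fromℤ (m ℤ.⊖ n)                    ≈⟨ fromℤ-⊖ m n ⟩
      m ×′ 1# - n ×′ 1#                   ≈⟨ cancel-1# _ _ ⟩
      (1# + m ×′ 1#) - (1# + n ×′ 1#)     ≈⟨ +-cong (×-homo-+ 1# 1 m) (-‿cong (×-homo-+ 1# 1 n)) ⟨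
      suc m ×′ 1# - suc n ×′ 1#           ∎

    fromℤ-+ : ∀ i j → fromℤ (i ℤ.+ j) ≈ fromℤ i + fromℤ j
    fromℤ-+ (+ m)    (+ n)    = ×-homo-+ 1# m n
    fromℤ-+ (+ m)    -[1+ n ] = fromℤ-⊖ m (suc n)
    fromℤ-+ -[1+ m ] (+ n)    = trans (fromℤ-⊖ n (suc m)) (+-comm _ _)
    fromℤ-+ -[1+ m ] -[1+ n ] = begin
      - (suc (suc (m ℕ.+ n)) ×′ 1#)        ≡⟨ ≡.cong (λ k → - (k ×′ 1#)) (ℕ.+-suc (suc m) n) ⟨
      - ((suc m ℕ.+ suc n) ×′ 1#)          ≈⟨ -‿cong (×-homo-+ 1# (suc m) (suc n)) ⟩
      - (suc m ×′ 1# + suc n ×′ 1#)        ≈⟨ -‿+-comm _ _ ⟨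
      - (suc m ×′ 1#) - suc n ×′ 1#        ∎

    fromℤ-* : ∀ i j → fromℤ (i ℤ.* j) ≈ fromℤ i * fromℤ j
    fromℤ-* (+ m) (+ n) = trans (reflexive (≡.cong fromℤ (≡.sym (ℤ.pos-* m n)))) (×1-homo-* m n)
    fromℤ-* (+ m) -[1+ n ] = begin
      fromℤ (+ m ℤ.* -[1+ n ])             ≡⟨ ≡.cong fromℤ (ℤ.neg-distribʳ-* (+ m) (+ suc n)) ⟨
      fromℤ (ℤ.- (+ m ℤ.* + suc n))        ≡⟨ ≡.cong (λ i → fromℤ (ℤ.- i)) (ℤ.pos-* m (suc n)) ⟨
      fromℤ (ℤ.- (+ (m ℕ.* suc n)))        ≈⟨ fromℤ-neg (m ℕ.* suc n) ⟩
      - ((m ℕ.* suc n) ×′ 1#)              ≈⟨ -‿cong (×1-homo-* m (suc n)) ⟩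
      - (m ×′ 1# * suc n ×′ 1#)            ≈⟨ -‿distribʳ-* _ _ ⟩
      m ×′ 1# * - (suc n ×′ 1#)            ∎
    fromℤ-* -[1+ m ] (+ n) = begin
      fromℤ (-[1+ m ] ℤ.* + n)             ≡⟨ ≡.cong fromℤ (ℤ.neg-distribˡ-* (+ suc m) (+ n)) ⟨
      fromℤ (ℤ.- (+ suc m ℤ.* + n))        ≡⟨ ≡.cong (λ i → fromℤ (ℤ.- i)) (ℤ.pos-* (suc m) n) ⟨
      fromℤ (ℤ.- (+ (suc m ℕ.* n)))        ≈⟨ fromℤ-neg (suc m ℕ.* n) ⟩
      - ((suc m ℕ.* n) ×′ 1#)              ≈⟨ -‿cong (×1-homo-* (suc m) n) ⟩
      - (suc m ×′ 1# * n ×′ 1#)            ≈⟨ -‿distribˡ-* _ _ ⟩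
      - (suc m ×′ 1#) * n ×′ 1#            ∎
    fromℤ-* -[1+ m ] -[1+ n ] = begin
      (suc m ℕ.* suc n) ×′ 1#              ≈⟨ ×1-homo-* (suc m) (suc n) ⟩
      suc m ×′ 1# * suc n ×′ 1#            ≈⟨ -‿involutive _ ⟨
      - - (suc m ×′ 1# * suc n ×′ 1#)      ≈⟨ -‿cong (-‿distribʳ-* _ _) ⟩
      - (suc m ×′ 1# * - (suc n ×′ 1#))    ≈⟨ -‿distribˡ-* _ _ ⟩
      - (suc m ×′ 1#) * - (suc n ×′ 1#)    ∎

    fromℤ-‿- : ∀ i → fromℤ (ℤ.- i) ≈ - fromℤ i
    fromℤ-‿- (+ n)    = fromℤ-neg n
    fromℤ-‿- -[1+ n ] = sym (-‿involutive _)

    homomorphism : ℤ.+-*-rawRing -Raw-AlmostCommutative⟶ fromCommutativeRing commutativeRing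
    homomorphism = record
      { ⟦_⟧    = fromℤ
      ; +-homo = fromℤ-+
      ; *-homo = fromℤ-*
      ; -‿homo = fromℤ-‿-
      ; 0-homo = refl
      ; 1-homo = refl
      }

    fromℤ-≟ : ∀ i j → Maybe (fromℤ i ≈ fromℤ j)
    fromℤ-≟ i j = Maybe.map (λ i≡j → reflexive (≡.cong fromℤ i≡j)) (dec⇒maybe (i ℤ.≟ j))

    open RingSolver ℤ.+-*-rawRing (fromCommutativeRing commutativeRing) homomorphism fromℤ-≟ public

    𝟘 𝟙 : ∀ {n} → Polynomial n
    𝟘 = con (+ 0)
    𝟙 = con (+ 1)


  open Solver public using (solve; _:=_; _:+_; _:*_; _:-_; 𝟘; 𝟙)

  totalOrder : TotalOrder 0ℓ 0ℓ 0ℓ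
  totalOrder = record { isTotalOrder = isTotalOrder }

  open TotalOrder totalOrder public using (poset; total; antisym; ≤-respˡ-≈; ≤-respʳ-≈)
    renaming (refl to ≤-refl; reflexive to ≤-reflexive; trans to ≤-trans)

  module ≤-Reasoning = PartialOrderReasoning poset

  private module Strict = NonStrictToStrict _≈_ _≤_

  open Strict public using (<⇒≤)
  open PosetProperties poset public using (<⇒≱; <-trans; <-respˡ-≈; <-respʳ-≈)

  ≰⇒> : ∀ {x y} → ¬ x ≤ y → y < x
  ≰⇒> = Strict.≰⇒> sym ≤-reflexive total

  <-≤-trans : ∀ {x y z} → x < y → y ≤ z → x < z
  <-≤-trans = Strict.<-≤-trans sym ≤-trans antisym ≤-respʳ-≈

  ≤-<-trans : ∀ {x y z} → x ≤ y → y < z → x < z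
  ≤-<-trans = Strict.≤-<-trans ≤-trans antisym ≤-respˡ-≈

  ≤⊎> : ∀ x y → x ≤ y ⊎ y < x
  ≤⊎> x y with lem {P = x ≤ y}
  ... | yes x≤y = inj₁ x≤y
  ... | no  x≰y = inj₂ (≰⇒> x≰y)

  -- Linear inequalities are reduced to a nonnegative difference, which is
  -- then identified by the ring solver.
  ≤-by : ∀ {x y e} → 0# ≤ e → y ≈ x + e → x ≤ y
  ≤-by {x} {y} {e} 0≤e y≈x+e = begin
    x      ≈⟨ +-identityˡ x ⟨
    0# + x ≤⟨ +-monoˡ-≤ x 0≤e ⟩
    e + x  ≈⟨ +-comm e x ⟩
    x + e  ≈⟨ y≈x+e ⟨
    y      ∎
    where open ≤-Reasoning

  0≤- : ∀ {x y} → x ≤ y → 0# ≤ y - x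
  0≤- {x} {y} x≤y = ≤-respˡ-≈ (-‿inverseʳ x) (+-monoˡ-≤ (- x) x≤y)

  0<- : ∀ {x y} → x < y → 0# < y - x
  0<- {x} {y} (x≤y , x≉y) = 0≤- x≤y , λ 0≈y-x → x≉y (begin
    x            ≈⟨ +-identityˡ x ⟨
    0# + x       ≈⟨ +-congʳ 0≈y-x ⟩
    (y - x) + x  ≈⟨ solve 2 (λ y x → (y :- x) :+ x := y) refl y x ⟩
    y            ∎)
    where open SetoidReasoning ℝ-setoid

  <-by : ∀ {x y e} → 0# < e → y ≈ x + e → x < y
  <-by {x} {y} {e} (0≤e , 0≉e) y≈x+e = ≤-by 0≤e y≈x+e , λ x≈y → 0≉e (begin
    0#           ≈⟨ -‿inverseʳ x ⟨
    x - x        ≈⟨ +-congʳ x≈y ⟩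
    y - x        ≈⟨ +-congʳ y≈x+e ⟩
    (x + e) - x  ≈⟨ solve 2 (λ x e → (x :+ e) :- x := e) refl x e ⟩
    e            ∎)
    where open SetoidReasoning ℝ-setoid

  +-mono-≤ : ∀ {x y u v} → x ≤ y → u ≤ v → x + u ≤ y + v
  +-mono-≤ {x} {y} {u} {v} x≤y u≤v = begin
    x + u ≤⟨ +-monoˡ-≤ u x≤y ⟩
    y + u ≈⟨ +-comm y u ⟩
    u + y ≤⟨ +-monoˡ-≤ y u≤v ⟩
    v + y ≈⟨ +-comm v y ⟩
    y + v ∎
    where open ≤-Reasoning

  +-nonNeg : ∀ {x y} → 0# ≤ x → 0# ≤ y → 0# ≤ x + y
  +-nonNeg 0≤x 0≤y = ≤-respˡ-≈ (+-identityˡ 0#) (+-mono-≤ 0≤x 0≤y)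

  +-pos-nonNeg : ∀ {x y} → 0# < x → 0# ≤ y → 0# < x + y
  +-pos-nonNeg {x} {y} 0<x 0≤y = <-≤-trans 0<x (≤-by 0≤y refl)

  *-monoˡ-≤ : ∀ {z x y} → 0# ≤ z → x ≤ y → z * x ≤ z * y
  *-monoˡ-≤ {z} {x} {y} 0≤z x≤y = ≤-by (*-nonNeg 0≤z (0≤- x≤y))
    (solve 3 (λ x y z → z :* y := z :* x :+ z :* (y :- x)) refl x y z)

  *-mono-≤ : ∀ {x y u v} → 0# ≤ x → x ≤ y → 0# ≤ u → u ≤ v → x * u ≤ y * v
  *-mono-≤ {x} {y} {u} {v} 0≤x x≤y 0≤u u≤v = begin
    x * u ≤⟨ *-monoˡ-≤ 0≤x u≤v ⟩
    x * v ≈⟨ *-comm x v ⟩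
    v * x ≤⟨ *-monoˡ-≤ (≤-trans 0≤u u≤v) x≤y ⟩
    v * y ≈⟨ *-comm v y ⟩
    y * v ∎
    where open ≤-Reasoning

  0<1 : 0# < 1#
  0<1 with total 0# 1#
  ... | inj₁ 0≤1 = 0≤1 , 0≉1
  -- The square of `0# - 1#`, nonnegative in this case, is `1#`.
  ... | inj₂ 1≤0 = ≤-respʳ-≈ (solve 0 ((𝟘 :- 𝟙) :* (𝟘 :- 𝟙) := 𝟙) refl) (*-nonNeg (0≤- 1≤0) (0≤- 1≤0)) , 0≉1

  ⁻¹-nonNeg : ∀ {x} → 0# < x → 0# ≤ x ⁻¹
  ⁻¹-nonNeg {x} (0≤x , 0≉x) with total 0# (x ⁻¹)
  ... | inj₁ 0≤x⁻¹ = 0≤x⁻¹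
  ... | inj₂ x⁻¹≤0 = ⊥-elim (<⇒≱ 0<1 (≤-by (*-nonNeg 0≤x (0≤- x⁻¹≤0)) (begin
    0#                       ≈⟨ solve 2 (λ x y → 𝟘 := x :* y :+ x :* (𝟘 :- y)) refl x (x ⁻¹) ⟩
    x * x ⁻¹ + x * (0# - x ⁻¹) ≈⟨ +-congʳ (⁻¹-inverseʳ (λ x≈0 → 0≉x (sym x≈0))) ⟩
    1# + x * (0# - x ⁻¹)     ∎)))
    where open SetoidReasoning ℝ-setoid

  *-pos : ∀ {x y} → 0# < x → 0# < y → 0# < x * y
  *-pos {x} {y} (0≤x , 0≉x) (0≤y , 0≉y) = *-nonNeg 0≤x 0≤y , λ 0≈xy → 0≉y (begin
    0#             ≈⟨ zeroʳ (x ⁻¹) ⟨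
    x ⁻¹ * 0#      ≈⟨ *-congˡ 0≈xy ⟩
    x ⁻¹ * (x * y) ≈⟨ solve 3 (λ x y z → z :* (x :* y) := (x :* z) :* y) refl x y (x ⁻¹) ⟩
    (x * x ⁻¹) * y ≈⟨ *-congʳ (⁻¹-inverseʳ (λ x≈0 → 0≉x (sym x≈0))) ⟩
    1# * y         ≈⟨ *-identityˡ y ⟩
    y              ∎)
    where open SetoidReasoning ℝ-setoid

  ≤⇒1≤/ : ∀ {x y} → 0# < x → x ≤ y → 1# ≤ y / x
  ≤⇒1≤/ {x} {y} 0<x x≤y = ≤-by (*-nonNeg (0≤- x≤y) (⁻¹-nonNeg 0<x)) (begin
    y * x ⁻¹                             ≈⟨ solve 3 (λ x y z → y :* z := x :* z :+ (y :- x) :* z) refl x y (x ⁻¹) ⟩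
    x * x ⁻¹ + (y - x) * x ⁻¹            ≈⟨ +-congʳ (⁻¹-inverseʳ (λ x≈0 → proj₂ 0<x (sym x≈0))) ⟩
    1# + (y - x) * x ⁻¹                  ∎)
    where open SetoidReasoning ℝ-setoid

  1≤/⇒≤ : ∀ {x y} → 0# < x → 1# ≤ y / x → x ≤ y
  1≤/⇒≤ {x} {y} 0<x 1≤y/x = begin
    x              ≈⟨ *-identityʳ x ⟨
    x * 1#         ≤⟨ *-monoˡ-≤ (<⇒≤ 0<x) 1≤y/x ⟩
    x * (y * x ⁻¹) ≈⟨ solve 3 (λ x y z → x :* (y :* z) := (x :* z) :* y) refl x y (x ⁻¹) ⟩
    (x * x ⁻¹) * y ≈⟨ *-congʳ (⁻¹-inverseʳ (λ x≈0 → proj₂ 0<x (sym x≈0))) ⟩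
    1# * y         ≈⟨ *-identityˡ y ⟩
    y              ∎
    where open ≤-Reasoning

  ½ : ℝ
  ½ = (1# + 1#) ⁻¹

  0<2 : 0# < 1# + 1#
  0<2 = +-pos-nonNeg 0<1 (<⇒≤ 0<1)

  ½+½≈1 : ½ + ½ ≈ 1#
  ½+½≈1 = trans (solve 1 (λ h → h :+ h := (𝟙 :+ 𝟙) :* h) refl ½)
                (⁻¹-inverseʳ (λ 2≈0 → proj₂ 0<2 (sym 2≈0)))

  0<½ : 0# < ½
  0<½ = ⁻¹-nonNeg 0<2 , λ 0≈½ → 0≉1 (trans (trans (sym (+-identityˡ 0#)) (+-cong 0≈½ 0≈½)) ½+½≈1)

  halves : ∀ x → x * ½ + x * ½ ≈ x
  halves x = trans (sym (distribˡ x ½ ½)) (trans (*-congˡ ½+½≈1) (*-identityʳ x))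

  *½-pos : ∀ {x} → 0# < x → 0# < x * ½
  *½-pos 0<x = *-pos 0<x 0<½

  -- The lower bounds of an infinitely halved positive sequence are closed
  -- under doubling, so their supremum cannot be positive.
  halving-null : (w : ℕ → ℝ) → (∀ k → w k ≈ w (suc k) + w (suc k)) →
                 ∀ {ε} → 0# < ε → ∃[ k ] w k < ε
  halving-null w halve {ε} 0<ε with lem {P = ∃[ k ] w k < ε}
  ... | yes found = found
  ... | no  none  = ⊥-elim (<⇒≱ 0<ε (≤-trans ε≤σ σ≤0))
    where
    LB : ℝ → Set
    LB x = ∀ k → x ≤ w k

    ε∈LB : LB ε
    ε∈LB k with ≤⊎> ε (w k)
    ... | inj₁ ε≤wk = ε≤wk
    ... | inj₂ wk<ε = ⊥-elim (none (k , wk<ε))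

    double : ∀ {x} → LB x → LB (x + x)
    double lb k = ≤-respʳ-≈ (sym (halve k)) (+-mono-≤ (lb (suc k)) (lb (suc k)))

    supremum = complete LB (ε , ε∈LB) (w 0 , λ lb → lb 0)
    σ = proj₁ supremum

    ε≤σ : ε ≤ σ
    ε≤σ = proj₁ (proj₂ supremum) ε∈LB

    σ≤½σ : σ ≤ ½ * σ
    σ≤½σ = proj₂ (proj₂ supremum) λ {x} lb → begin
      x           ≈⟨ halves x ⟨
      x * ½ + x * ½ ≈⟨ solve 2 (λ x h → x :* h :+ x :* h := h :* (x :+ x)) refl x ½ ⟩
      ½ * (x + x) ≤⟨ *-monoˡ-≤ (<⇒≤ 0<½) (proj₁ (proj₂ supremum) (double lb)) ⟩
      ½ * σ       ∎
      where open ≤-Reasoning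

    σ≤0 : σ ≤ 0#
    σ≤0 = ≤-by (0≤- (+-mono-≤ σ≤½σ σ≤½σ)) (begin
      0#                                         ≈⟨ solve 1 (λ s → 𝟘 := s :+ (s :- (s :+ s))) refl σ ⟩
      σ + (σ - (σ + σ))                          ≈⟨ +-congˡ (+-congʳ (halves σ)) ⟨
      σ + ((σ * ½ + σ * ½) - (σ + σ))            ≈⟨ +-congˡ (+-congʳ (+-cong (*-comm σ ½) (*-comm σ ½))) ⟩
      σ + ((½ * σ + ½ * σ) - (σ + σ))            ∎)
      where open SetoidReasoning ℝ-setoid

-- Finite sums and products.

module Sums (lem : ∀ {ℓ} → ExcludedMiddle ℓ) (R : CompleteOrderedField) where

  open CompleteOrderedField R renaming (Carrier to ℝ; setoid to ℝ-setoid)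
  open OrderedField lem R
  open MonoidSum *-monoid public using () renaming (sum-cong-≋ to ∏-cong)

  private variable
    A B : Set
    d : ℕ

  Σₗ : List A → (A → ℝ) → ℝ
  Σₗ []       f = 0#
  Σₗ (x ∷ xs) f = f x + Σₗ xs f

  Σₗ-cong : ∀ (xs : List A) {f g} → (∀ x → f x ≈ g x) → Σₗ xs f ≈ Σₗ xs g
  Σₗ-cong []       f≈g = refl
  Σₗ-cong (x ∷ xs) f≈g = +-cong (f≈g x) (Σₗ-cong xs f≈g)

  Σₗ-mono : ∀ (xs : List A) {f g} → (∀ x → f x ≤ g x) → Σₗ xs f ≤ Σₗ xs g
  Σₗ-mono []       f≤g = ≤-refl
  Σₗ-mono (x ∷ xs) f≤g = +-mono-≤ (f≤g x) (Σₗ-mono xs f≤g)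

  Σₗ-nonNeg : ∀ (xs : List A) {f} → (∀ x → 0# ≤ f x) → 0# ≤ Σₗ xs f
  Σₗ-nonNeg []       0≤f = ≤-refl
  Σₗ-nonNeg (x ∷ xs) 0≤f = +-nonNeg (0≤f x) (Σₗ-nonNeg xs 0≤f)

  Σₗ-++ : ∀ (xs ys : List A) f → Σₗ (xs ++ ys) f ≈ Σₗ xs f + Σₗ ys f
  Σₗ-++ []       ys f = sym (+-identityˡ _)
  Σₗ-++ (x ∷ xs) ys f = trans (+-congˡ (Σₗ-++ xs ys f)) (sym (+-assoc _ _ _))

  Σₗ-map : ∀ (g : A → B) xs f → Σₗ (map g xs) f ≡ Σₗ xs (λ x → f (g x))
  Σₗ-map g []       f = ≡.refl
  Σₗ-map g (x ∷ xs) f = ≡.cong (f (g x) +_) (Σₗ-map g xs f)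

  Σₗ-concatMap : ∀ (g : A → List B) xs f → Σₗ (concatMap g xs) f ≈ Σₗ xs (λ x → Σₗ (g x) f)
  Σₗ-concatMap g []       f = refl
  Σₗ-concatMap g (x ∷ xs) f = trans (Σₗ-++ (g x) _ f) (+-congˡ (Σₗ-concatMap g xs f))

  Σₗ-+ : ∀ (xs : List A) f g → Σₗ xs (λ x → f x + g x) ≈ Σₗ xs f + Σₗ xs g
  Σₗ-+ []       f g = sym (+-identityˡ _)
  Σₗ-+ (x ∷ xs) f g = trans (+-congˡ (Σₗ-+ xs f g))
    (solve 4 (λ a b c d → (a :+ b) :+ (c :+ d) := (a :+ c) :+ (b :+ d)) refl _ _ _ _)

  Σₗ-*ˡ : ∀ (xs : List A) c f → Σₗ xs (λ x → c * f x) ≈ c * Σₗ xs f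
  Σₗ-*ˡ []       c f = sym (zeroʳ c)
  Σₗ-*ˡ (x ∷ xs) c f = trans (+-congˡ (Σₗ-*ˡ xs c f)) (sym (distribˡ c _ _))

  Σₗ-*ʳ : ∀ (xs : List A) c f → Σₗ xs (λ x → f x * c) ≈ Σₗ xs f * c
  Σₗ-*ʳ xs c f = trans (Σₗ-cong xs λ x → *-comm (f x) c) (trans (Σₗ-*ˡ xs c f) (*-comm c _))

  Σₗ-const : ∀ (xs : List A) c → Σₗ xs (λ _ → c) ≈ fromℕ (length xs) * c
  Σₗ-const []       c = sym (zeroˡ c)
  Σₗ-const (x ∷ xs) c = trans (+-congˡ (Σₗ-const xs c))
    (sym (trans (distribʳ c 1# _) (+-congʳ (*-identityˡ c))))

  Σₗ-filterᵇ : ∀ (p : A → Bool) xs {f} → (∀ x → 0# ≤ f x) → Σₗ (filterᵇ p xs) f ≤ Σₗ xs f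
  Σₗ-filterᵇ p []       0≤f = ≤-refl
  Σₗ-filterᵇ p (x ∷ xs) {f} 0≤f with p x
  ... | true  = +-mono-≤ ≤-refl (Σₗ-filterᵇ p xs 0≤f)
  ... | false = ≤-trans (Σₗ-filterᵇ p xs 0≤f) (≤-by (0≤f x) (+-comm (f x) _))

  Σₗ-allFin : ∀ n (f : Fin (suc n) → ℝ) →
              Σₗ (allFin (suc n)) f ≡ f Fin.zero + Σₗ (allFin n) (λ j → f (Fin.suc j))
  Σₗ-allFin n f = ≡.cong (f Fin.zero +_) (≡.trans
    (≡.cong (λ js → Σₗ js f) (≡.sym (map-tabulate (λ j → j) Fin.suc)))
    (Σₗ-map Fin.suc (allFin n) f))

  ∏-nonNeg : ∀ {f : Fin d → ℝ} → (∀ i → 0# ≤ f i) → 0# ≤ ∏ f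
  ∏-nonNeg {zero}  0≤f = <⇒≤ 0<1
  ∏-nonNeg {suc d} 0≤f = *-nonNeg (0≤f Fin.zero) (∏-nonNeg (λ i → 0≤f (Fin.suc i)))

  ∏-pos : ∀ {f : Fin d → ℝ} → (∀ i → 0# < f i) → 0# < ∏ f
  ∏-pos {zero}  0<f = 0<1
  ∏-pos {suc d} 0<f = *-pos (0<f Fin.zero) (∏-pos (λ i → 0<f (Fin.suc i)))

  ∏-mono : ∀ {f g : Fin d → ℝ} → (∀ i → 0# ≤ f i) → (∀ i → f i ≤ g i) → ∏ f ≤ ∏ g
  ∏-mono {zero}  0≤f f≤g = ≤-refl
  ∏-mono {suc d} 0≤f f≤g = *-mono-≤ (0≤f Fin.zero) (f≤g Fin.zero)
    (∏-nonNeg (λ i → 0≤f (Fin.suc i))) (∏-mono (λ i → 0≤f (Fin.suc i)) (λ i → f≤g (Fin.suc i)))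

  -- Expanding a product of sums gives one term per multi-index. Through this, volume identities in
  -- dimension d reduce to one coordinate at a time.
  Σₗ-allIndices-∏ : ∀ (n : Fin d → ℕ) (f : ∀ i → Fin (n i) → ℝ) →
                    Σₗ (allIndices n) (λ x → ∏ (λ i → f i (x i))) ≈ ∏ (λ i → Σₗ (allFin (n i)) (f i))
  Σₗ-allIndices-∏ {zero}  n f = +-identityʳ 1#
  Σₗ-allIndices-∏ {suc d} n f = begin
    Σₗ (allIndices n) (λ x → ∏ (λ i → f i (x i)))
      ≈⟨ Σₗ-concatMap (λ j → map (cons j) tails) (allFin (n Fin.zero)) _ ⟩
    Σₗ (allFin (n Fin.zero)) (λ j → Σₗ (map (cons j) tails) (λ x → ∏ (λ i → f i (x i))))
      ≈⟨ Σₗ-cong (allFin (n Fin.zero)) (λ j → begin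
        Σₗ (map (cons j) tails) (λ x → ∏ (λ i → f i (x i)))
          ≡⟨ Σₗ-map (cons j) tails _ ⟩
        Σₗ tails (λ y → f Fin.zero j * ∏ (λ i → f (Fin.suc i) (y i)))
          ≈⟨ Σₗ-*ˡ tails (f Fin.zero j) _ ⟩
        f Fin.zero j * Σₗ tails (λ y → ∏ (λ i → f (Fin.suc i) (y i)))
          ≈⟨ *-congˡ (Σₗ-allIndices-∏ (λ i → n (Fin.suc i)) (λ i → f (Fin.suc i))) ⟩
        f Fin.zero j * ∏ (λ i → Σₗ (allFin (n (Fin.suc i))) (f (Fin.suc i))) ∎) ⟩
    Σₗ (allFin (n Fin.zero)) (λ j → f Fin.zero j * ∏ (λ i → Σₗ (allFin (n (Fin.suc i))) (f (Fin.suc i))))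
      ≈⟨ Σₗ-*ʳ (allFin (n Fin.zero)) _ (f Fin.zero) ⟩
    ∏ (λ i → Σₗ (allFin (n i)) (f i)) ∎
    where
    open SetoidReasoning ℝ-setoid
    tails = allIndices (λ i → n (Fin.suc i))
    cons : Fin (n Fin.zero) → Index (λ i → n (Fin.suc i)) → Index n
    cons = Fin.∀-cons {P = λ i → Fin (n i)}

  partialSum : (ℕ → ℝ) → ℕ → ℝ
  partialSum a n = ∑ {n} (λ k → a (toℕ k))

  partialSum-+ : ∀ a b n → partialSum (λ k → a k + b k) n ≈ partialSum a n + partialSum b n
  partialSum-+ a b n = CommutativeMonoidSum.∑-distrib-+ +-commutativeMonoid {n} (λ k → a (toℕ k)) (λ k → b (toℕ k))

  partialSum-cong : ∀ {a b} → (∀ k → a k ≈ b k) → ∀ n → partialSum a n ≈ partialSum b n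
  partialSum-cong a≈b n = MonoidSum.sum-cong-≋ +-monoid {n} (λ k → a≈b (toℕ k))

  partialSum-mono : ∀ {a b} → (∀ k → a k ≤ b k) → ∀ n → partialSum a n ≤ partialSum b n
  partialSum-mono a≤b zero    = ≤-refl
  partialSum-mono a≤b (suc n) = +-mono-≤ (a≤b 0) (partialSum-mono (λ k → a≤b (suc k)) n)

  partialSum-nonNeg : ∀ {a} → (∀ k → 0# ≤ a k) → ∀ n → 0# ≤ partialSum a n
  partialSum-nonNeg 0≤a zero    = ≤-refl
  partialSum-nonNeg 0≤a (suc n) = +-nonNeg (0≤a 0) (partialSum-nonNeg (λ k → 0≤a (suc k)) n)

  partialSum-monoʳ : ∀ {a} → (∀ k → 0# ≤ a k) → ∀ {m n} → m ℕ.≤ n → partialSum a m ≤ partialSum a n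
  partialSum-monoʳ 0≤a {n = n} z≤n = partialSum-nonNeg 0≤a n
  partialSum-monoʳ 0≤a (s≤s m≤n)   = +-mono-≤ ≤-refl (partialSum-monoʳ (λ k → 0≤a (suc k)) m≤n)

  partialSum-term : ∀ {a} → (∀ k → 0# ≤ a k) → ∀ k → a k ≤ partialSum a (suc k)
  partialSum-term 0≤a zero    = ≤-reflexive (sym (+-identityʳ _))
  partialSum-term {a} 0≤a (suc k) = ≤-trans (partialSum-term (λ j → 0≤a (suc j)) k) (≤-by (0≤a 0) (+-comm (a 0) _))

-- Volumes of intersections of cubes with boxes.

module Overlaps (lem : ∀ {ℓ} → ExcludedMiddle ℓ) (R : CompleteOrderedField) where

  open CompleteOrderedField R renaming (Carrier to ℝ; setoid to ℝ-setoid)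
  open Extremal lem R
  open OrderedField lem R
  open Sums lem R

  private variable
    d : ℕ

  -- For `u ≤ v`, the point of [u , v] nearest to `x`; as `x` runs from a to b, it travels the
  -- length of [u , v] ∩ [a , b].
  clamp : ℝ → ℝ → ℝ → ℝ
  clamp u v x with ≤⊎> x u | ≤⊎> v x
  ... | inj₁ _ | _      = u
  ... | inj₂ _ | inj₁ _ = v
  ... | inj₂ _ | inj₂ _ = x

  clamp-below : ∀ {u v x} → x ≤ u → clamp u v x ≈ u
  clamp-below {u} {v} {x} x≤u with ≤⊎> x u | ≤⊎> v x
  ... | inj₁ _   | _ = refl
  ... | inj₂ u<x | _ = ⊥-elim (<⇒≱ u<x x≤u)

  clamp-above : ∀ {u v x} → u ≤ v → v ≤ x → clamp u v x ≈ v
  clamp-above {u} {v} {x} u≤v v≤x with ≤⊎> x u | ≤⊎> v x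
  ... | inj₁ x≤u | _        = antisym u≤v (≤-trans v≤x x≤u)
  ... | inj₂ _   | inj₁ _   = refl
  ... | inj₂ _   | inj₂ x<v = ⊥-elim (<⇒≱ x<v v≤x)

  clamp-inside : ∀ {u v x} → u ≤ x → x ≤ v → clamp u v x ≈ x
  clamp-inside {u} {v} {x} u≤x x≤v with ≤⊎> x u | ≤⊎> v x
  ... | inj₁ x≤u | _        = antisym u≤x x≤u
  ... | inj₂ _   | inj₁ v≤x = antisym v≤x x≤v
  ... | inj₂ _   | inj₂ _   = refl

  -- To the left of `v` the second summand rests at `v`, to the right the first one does; the other
  -- summand agrees with `clamp u w x`.
  clamp-split : ∀ {u v w} → u ≤ v → v ≤ w → ∀ x → clamp u v x + clamp v w x ≈ clamp u w x + v
  clamp-split {u} {v} {w} u≤v v≤w x with total x v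
  ... | inj₁ x≤v = +-cong (below-v (total x u)) (clamp-below x≤v)
    where
    below-v : x ≤ u ⊎ u ≤ x → clamp u v x ≈ clamp u w x
    below-v (inj₁ x≤u) = trans (clamp-below x≤u) (sym (clamp-below x≤u))
    below-v (inj₂ u≤x) = trans (clamp-inside u≤x x≤v) (sym (clamp-inside u≤x (≤-trans x≤v v≤w)))
  ... | inj₂ v≤x = trans (+-comm _ _) (+-cong (above-v (total x w)) (clamp-above u≤v v≤x))
    where
    above-v : x ≤ w ⊎ w ≤ x → clamp v w x ≈ clamp u w x
    above-v (inj₁ x≤w) = trans (clamp-inside v≤x x≤w) (sym (clamp-inside (≤-trans u≤v v≤x) x≤w))
    above-v (inj₂ w≤x) = trans (clamp-above v≤w w≤x) (sym (clamp-above (≤-trans u≤v v≤w) w≤x))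

  -- The length of the intersection of the intervals [u , v] and [a , b].
  overlap₁ : ℝ → ℝ → ℝ → ℝ → ℝ
  overlap₁ u v a b = clamp u v b - clamp u v a

  -- Clamping is monotone and never increases distances. The cases are the two positions without
  -- common interior, and four in which each end of the intersection comes from one of the two
  -- intervals.
  overlap₁-bounds : ∀ {u v a b} → u ≤ v → a ≤ b → 0# ≤ overlap₁ u v a b × overlap₁ u v a b ≤ b - a
  overlap₁-bounds {u} {v} {a} {b} u≤v a≤b = cases (≤⊎> b u) (≤⊎> v a)
    where
    Bounds = 0# ≤ overlap₁ u v a b × overlap₁ u v a b ≤ b - a

    within : ∀ {x y} → clamp u v a ≈ x → clamp u v b ≈ y → x ≤ y → y - x ≤ b - a → Bounds
    within a≈x b≈y x≤y y-x≤ = ≤-respʳ-≈ (sym eq) (0≤- x≤y) , ≤-respˡ-≈ (sym eq) y-x≤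
      where eq = +-cong b≈y (-‿cong a≈x)

    shrink : ∀ {x y} → a ≤ x → y ≤ b → y - x ≤ b - a
    shrink {x} {y} a≤x y≤b = ≤-by (+-nonNeg (0≤- a≤x) (0≤- y≤b))
      (solve 4 (λ a b x y → b :- a := (y :- x) :+ ((x :- a) :+ (b :- y))) refl a b x y)

    trivial : ∀ x → x - x ≤ b - a
    trivial x = ≤-respˡ-≈ (sym (-‿inverseʳ x)) (0≤- a≤b)

    ends : u < b → a < v → a ≤ u ⊎ u ≤ a → b ≤ v ⊎ v ≤ b → Bounds
    ends u<b a<v (inj₁ a≤u) (inj₁ b≤v) =
      within (clamp-below a≤u) (clamp-inside (<⇒≤ u<b) b≤v) (<⇒≤ u<b) (shrink a≤u ≤-refl)
    ends u<b a<v (inj₁ a≤u) (inj₂ v≤b) =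
      within (clamp-below a≤u) (clamp-above u≤v v≤b) u≤v (shrink a≤u v≤b)
    ends u<b a<v (inj₂ u≤a) (inj₁ b≤v) =
      within (clamp-inside u≤a (<⇒≤ a<v)) (clamp-inside (<⇒≤ u<b) b≤v) a≤b (shrink ≤-refl ≤-refl)
    ends u<b a<v (inj₂ u≤a) (inj₂ v≤b) =
      within (clamp-inside u≤a (<⇒≤ a<v)) (clamp-above u≤v v≤b) (<⇒≤ a<v) (shrink ≤-refl v≤b)

    cases : b ≤ u ⊎ u < b → v ≤ a ⊎ a < v → Bounds
    cases (inj₁ b≤u) _          = within (clamp-below (≤-trans a≤b b≤u)) (clamp-below b≤u) ≤-refl (trivial u)
    cases (inj₂ u<b) (inj₁ v≤a) = within (clamp-above u≤v v≤a) (clamp-above u≤v (≤-trans v≤a a≤b)) ≤-refl (trivial v)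
    cases (inj₂ u<b) (inj₂ a<v) = ends u<b a<v (total a u) (total b v)

  overlap₁-nonNeg : ∀ {u v a b} → u ≤ v → a ≤ b → 0# ≤ overlap₁ u v a b
  overlap₁-nonNeg u≤v a≤b = proj₁ (overlap₁-bounds u≤v a≤b)

  overlap₁-inside : ∀ {u v a b} → u ≤ v → a ≤ u → v ≤ b → overlap₁ u v a b ≈ v - u
  overlap₁-inside u≤v a≤u v≤b = +-cong (clamp-above u≤v v≤b) (-‿cong (clamp-below a≤u))

  overlap₁-split : ∀ {u v w} a b → u ≤ v → v ≤ w → overlap₁ u v a b + overlap₁ v w a b ≈ overlap₁ u w a b
  overlap₁-split {u} {v} {w} a b u≤v v≤w = begin
    (clamp u v b - clamp u v a) + (clamp v w b - clamp v w a)
      ≈⟨ solve 4 (λ x y z t → (x :- y) :+ (z :- t) := (x :+ z) :- (y :+ t)) refl _ _ _ _ ⟩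
    (clamp u v b + clamp v w b) - (clamp u v a + clamp v w a)
      ≈⟨ +-cong (clamp-split u≤v v≤w b) (-‿cong (clamp-split u≤v v≤w a)) ⟩
    (clamp u w b + v) - (clamp u w a + v)
      ≈⟨ solve 3 (λ x y z → (x :+ z) :- (y :+ z) := x :- y) refl _ _ _ ⟩
    clamp u w b - clamp u w a ∎
    where open SetoidReasoning ℝ-setoid

  overlap₁-mono : ∀ {u u′ v′ v a b} → a ≤ b → u ≤ u′ → u′ ≤ v′ → v′ ≤ v →
                  overlap₁ u′ v′ a b ≤ overlap₁ u v a b
  overlap₁-mono {u} {u′} {v′} {v} {a} {b} a≤b u≤u′ u′≤v′ v′≤v = begin
    overlap₁ u′ v′ a b
      ≤⟨ ≤-by (overlap₁-nonNeg v′≤v a≤b) (sym (overlap₁-split a b u′≤v′ v′≤v)) ⟩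
    overlap₁ u′ v a b
      ≤⟨ ≤-by (overlap₁-nonNeg u≤u′ a≤b) (trans (sym (overlap₁-split a b u≤u′ (≤-trans u′≤v′ v′≤v))) (+-comm _ _)) ⟩
    overlap₁ u v a b ∎
    where open ≤-Reasoning

  overlap₁-chain : ∀ {a b} (u : ℕ → ℝ) → (∀ k → u k ≤ u (suc k)) → a ≤ b → ∀ n →
                   Σₗ (allFin n) (λ j → overlap₁ (u (toℕ j)) (u (suc (toℕ j))) a b) ≈ overlap₁ (u 0) (u n) a b
  overlap₁-chain {a} {b} u u-mono a≤b zero = antisym (overlap₁-nonNeg ≤-refl a≤b)
    (≤-reflexive (trans (+-cong (at b) (-‿cong (at a))) (-‿inverseʳ (u 0))))
    where
    at : ∀ x → clamp (u 0) (u 0) x ≈ u 0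
    at x with total x (u 0)
    ... | inj₁ x≤u = clamp-below x≤u
    ... | inj₂ u≤x = clamp-above ≤-refl u≤x
  overlap₁-chain {a} {b} u u-mono a≤b (suc n) = begin
    Σₗ (allFin (suc n)) (λ j → overlap₁ (u (toℕ j)) (u (suc (toℕ j))) a b)
      ≡⟨ Σₗ-allFin n _ ⟩
    overlap₁ (u 0) (u 1) a b + Σₗ (allFin n) (λ j → overlap₁ (u (suc (toℕ j))) (u (suc (suc (toℕ j)))) a b)
      ≈⟨ +-congˡ (overlap₁-chain (λ k → u (suc k)) (λ k → u-mono (suc k)) a≤b n) ⟩
    overlap₁ (u 0) (u 1) a b + overlap₁ (u 1) (u (suc n)) a b
      ≈⟨ overlap₁-split a b (u-mono 0) (from-1 n) ⟩
    overlap₁ (u 0) (u (suc n)) a b ∎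
    where
    open SetoidReasoning ℝ-setoid
    from-1 : ∀ k → u 1 ≤ u (suc k)
    from-1 zero    = ≤-refl
    from-1 (suc k) = ≤-trans (from-1 k) (u-mono (suc k))

  cubeVolume : ℕ → ℝ → ℝ
  cubeVolume d w = ∏ {d} (λ _ → w)

  overlapVolume : Point d → ℝ → Box d → ℝ
  overlapVolume l w B = ∏ (λ i → overlap₁ (l i) (l i + w) (lower B i) (upper B i))

  InCube : Point d → ℝ → Point d → Set
  InCube l w p = ∀ i → l i ≤ p i × p i ≤ l i + w

  x≤x+w : ∀ {x w} → 0# ≤ w → x ≤ x + w
  x≤x+w 0≤w = ≤-by 0≤w refl

  overlap-nonNeg : ∀ (l : Point d) {w} → 0# ≤ w → ∀ B → 0# ≤ overlapVolume l w B
  overlap-nonNeg l 0≤w B = ∏-nonNeg (λ i → overlap₁-nonNeg (x≤x+w 0≤w) (ordered B i))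

  overlap-inside : ∀ (l : Point d) {w} → 0# ≤ w → ∀ B →
                   (∀ i → lower B i ≤ l i × l i + w ≤ upper B i) → cubeVolume d w ≈ overlapVolume l w B
  overlap-inside l {w} 0≤w B l⊆B = ∏-cong λ i →
    trans (solve 2 (λ l w → w := (l :+ w) :- l) refl (l i) w)
          (sym (overlap₁-inside (x≤x+w 0≤w) (proj₁ (l⊆B i)) (proj₂ (l⊆B i))))

  shift : Fin 2 → ℝ → ℝ → ℝ
  shift Fin.zero    w x = x
  shift (Fin.suc _) w x = x + w

  -- The corners of the 2ᵈ cubes of side w into which a cube of side w + w falls.
  child : Point d → ℝ → Index {d} (λ _ → 2) → Point d
  child l w b i = shift (b i) w (l i)

  two : Fin d → ℕ
  two _ = 2

  shift-lower : ∀ b {w x} → 0# ≤ w → x ≤ shift b w x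
  shift-lower Fin.zero    0≤w = ≤-refl
  shift-lower (Fin.suc _) 0≤w = x≤x+w 0≤w

  shift-upper : ∀ b {w x} → 0# ≤ w → shift b (w * ½) x + w * ½ ≤ x + w
  shift-upper Fin.zero {w} {x} 0≤w = ≤-by (*-nonNeg 0≤w (<⇒≤ 0<½))
    (trans (+-congˡ (sym (halves w))) (sym (+-assoc x _ _)))
  shift-upper (Fin.suc _) {w} {x} 0≤w = ≤-reflexive (trans (+-assoc x _ _) (+-congˡ (halves w)))

  children-volume : ∀ d w → Σₗ (allIndices (two {d})) (λ _ → cubeVolume d (w * ½)) ≈ cubeVolume d w
  children-volume d w = trans (Σₗ-allIndices-∏ (two {d}) (λ _ _ → w * ½))
    (∏-cong {d} (λ i → trans (+-congˡ (+-identityʳ _)) (halves w)))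

  children-overlap : ∀ (l : Point d) {w} → 0# ≤ w → ∀ B →
                     Σₗ (allIndices (two {d})) (λ b → overlapVolume (child l (w * ½) b) (w * ½) B) ≤ overlapVolume l w B
  children-overlap {d} l {w} 0≤w B = begin
    Σₗ (allIndices (two {d})) (λ b → overlapVolume (child l w½ b) w½ B)
      ≈⟨ Σₗ-allIndices-∏ (two {d}) (λ i b → overlap₁ (shift b w½ (l i)) (shift b w½ (l i) + w½) (lower B i) (upper B i)) ⟩
    ∏ (λ i → side (l i) i + (side (l i + w½) i + 0#))
      ≤⟨ ∏-mono (λ i → +-nonNeg (side-nonNeg (l i) i) (+-nonNeg (side-nonNeg (l i + w½) i) ≤-refl)) (λ i → begin
         side (l i) i + (side (l i + w½) i + 0#)
           ≈⟨ +-congˡ (+-identityʳ _) ⟩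
         side (l i) i + side (l i + w½) i
           ≈⟨ overlap₁-split _ _ (x≤x+w 0≤w½) (x≤x+w 0≤w½) ⟩
         overlap₁ (l i) (l i + w½ + w½) (lower B i) (upper B i)
           -- The right ends agree only up to `≈`; monotonicity stands in for a congruence of
           -- `clamp` in its bounds.
           ≤⟨ overlap₁-mono (ordered B i) ≤-refl (≤-trans (x≤x+w 0≤w½) (x≤x+w 0≤w½)) (shift-upper (Fin.suc Fin.zero) 0≤w) ⟩
         overlap₁ (l i) (l i + w) (lower B i) (upper B i) ∎) ⟩
    overlapVolume l w B ∎
    where
    open ≤-Reasoning
    w½ = w * ½
    0≤w½ = *-nonNeg 0≤w (<⇒≤ 0<½)
    side : ℝ → Fin d → ℝ
    side x i = overlap₁ x (x + w½) (lower B i) (upper B i)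
    side-nonNeg : ∀ x i → 0# ≤ side x i
    side-nonNeg x i = overlap₁-nonNeg (x≤x+w 0≤w½) (ordered B i)

  positive-lowerBound : ∀ (f : Fin d → ℝ) → (∀ i → 0# < f i) → ∃[ ε ] 0# < ε × (∀ i → ε ≤ f i)
  positive-lowerBound {zero}  f 0<f = 1# , 0<1 , λ ()
  positive-lowerBound {suc d} f 0<f with positive-lowerBound (λ i → f (Fin.suc i)) (λ i → 0<f (Fin.suc i))
  ... | ε , 0<ε , ε≤f with total ε (f Fin.zero)
  ... | inj₁ ε≤f₀ = ε , 0<ε , λ { Fin.zero → ε≤f₀ ; (Fin.suc i) → ε≤f i }
  ... | inj₂ f₀≤ε = f Fin.zero , 0<f Fin.zero , λ { Fin.zero → ≤-refl ; (Fin.suc i) → ≤-trans f₀≤ε (ε≤f i) }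

  width : ℝ → ℕ → ℝ
  width w zero    = w
  width w (suc k) = width w k * ½

  width-pos : ∀ {w} → 0# < w → ∀ k → 0# < width w k
  width-pos 0<w zero    = 0<w
  width-pos 0<w (suc k) = *½-pos (width-pos 0<w k)

  width-null : ∀ w {ε} → 0# < ε → ∃[ k ] width w k < ε
  width-null w = halving-null (width w) (λ k → sym (halves (width w k)))

  -- Compactness of closed cubes, by bisection.

  module Covering (B : ℕ → Box d) where

    -- Only the parts of the boxes inside the cube are counted. The contributions of one box to
    -- non-overlapping cubes then add up, so the property passes from the children to the whole
    -- cube.
    Filled : Point d → ℝ → Set
    Filled l w = ∃[ N ] cubeVolume d w ≤ partialSum (λ k → overlapVolume l w (B k)) N

    Filled-sum : ∀ {A : Set} (xs : List A) (c : A → Point d) {w} → 0# ≤ w → All (λ x → Filled (c x) w) xs →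
                 ∃[ N ] Σₗ xs (λ _ → cubeVolume d w) ≤ partialSum (λ k → Σₗ xs (λ x → overlapVolume (c x) w (B k))) N
    Filled-sum []       c 0≤w [] = 0 , ≤-refl
    Filled-sum (x ∷ xs) c {w} 0≤w (head ∷ filled) with head | Filled-sum xs c 0≤w filled
    ... | M , vol≤ | N , sum≤ = M ℕ.⊔ N , (begin
      cubeVolume d w + Σₗ xs (λ _ → cubeVolume d w)
        ≤⟨ +-mono-≤ vol≤ sum≤ ⟩
      partialSum first M + partialSum rest N
        ≤⟨ +-mono-≤ (partialSum-monoʳ (λ k → overlap-nonNeg (c x) 0≤w (B k)) (ℕ.m≤m⊔n M N))
                    (partialSum-monoʳ (λ k → Σₗ-nonNeg xs (λ y → overlap-nonNeg (c y) 0≤w (B k))) (ℕ.m≤n⊔m M N)) ⟩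
      partialSum first (M ℕ.⊔ N) + partialSum rest (M ℕ.⊔ N)
        ≈⟨ partialSum-+ first rest (M ℕ.⊔ N) ⟨
      partialSum (λ k → first k + rest k) (M ℕ.⊔ N) ∎)
      where
      open ≤-Reasoning
      first rest : ℕ → ℝ
      first k = overlapVolume (c x) w (B k)
      rest  k = Σₗ xs (λ y → overlapVolume (c y) w (B k))

    Filled-bisect : ∀ l {w} → 0# ≤ w → (∀ b → Filled (child l (w * ½) b) (w * ½)) → Filled l w
    Filled-bisect l {w} 0≤w filled
      with Filled-sum (allIndices (two {d})) (child l (w * ½)) (*-nonNeg 0≤w (<⇒≤ 0<½))
             (All.universal filled _)
    ... | N , sum≤ = N , (begin
      cubeVolume d w                                                ≈⟨ children-volume d w ⟨
      Σₗ (allIndices (two {d})) (λ _ → cubeVolume d (w * ½))        ≤⟨ sum≤ ⟩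
      partialSum (λ k → Σₗ (allIndices (two {d})) (λ b → overlapVolume (child l (w * ½) b) (w * ½) (B k))) N
        ≤⟨ partialSum-mono (λ k → children-overlap l 0≤w (B k)) N ⟩
      partialSum (λ k → overlapVolume l w (B k)) N                        ∎)
      where open ≤-Reasoning

    unfilled-child : ∀ l {w} → 0# ≤ w → ¬ Filled l w → ∃[ b ] ¬ Filled (child l (w * ½) b) (w * ½)
    unfilled-child l {w} 0≤w unfilled with lem {P = ∃[ b ] ¬ Filled (child l (w * ½) b) (w * ½)}
    ... | yes found = found
    ... | no  none  = ⊥-elim (unfilled (Filled-bisect l 0≤w filled))
      where
      filled : ∀ b → Filled (child l (w * ½) b) (w * ½)
      filled b with lem {P = Filled (child l (w * ½) b) (w * ½)}
      ... | yes f  = f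
      ... | no  ¬f = ⊥-elim (none (b , ¬f))

    -- Bisecting an unfilled cube forever leads to a point of the cube; but the
    -- cubes around it eventually lie in a single box.
    covered⇒Filled : ∀ l {w} → 0# < w → (∀ p → InCube l w p → ∃[ k ] Interior (B k) p) → Filled l w
    covered⇒Filled l {w} 0<w covered with lem {P = Filled l w}
    ... | yes filled   = filled
    ... | no  unfilled = ⊥-elim (contra (covered p (λ i → p-lower i 0 , p-upper i 0)))
      where
      0≤width : ∀ k → 0# ≤ width w k
      0≤width k = <⇒≤ (width-pos 0<w k)

      unfilledCube : ∀ k → ∃[ m ] ¬ Filled m (width w k)
      unfilledCube zero    = l , unfilled
      unfilledCube (suc k) = let m , ¬f = unfilledCube k
                                 b , ¬c = unfilled-child m (0≤width k) ¬f
                             in child m (width w (suc k)) b , ¬c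

      corner : ℕ → Point d
      corner k = proj₁ (unfilledCube k)

      corner-+ : ∀ i k j → corner k i ≤ corner (j ℕ.+ k) i ×
                 corner (j ℕ.+ k) i + width w (j ℕ.+ k) ≤ corner k i + width w k
      corner-+ i k zero    = ≤-refl , ≤-refl
      corner-+ i k (suc j) = let below , above = corner-+ i k j in
        ≤-trans below (shift-lower b (0≤width (suc j ℕ.+ k))) , ≤-trans (shift-upper b (0≤width (j ℕ.+ k))) above
        where b = proj₁ (unfilled-child (corner (j ℕ.+ k)) (0≤width (j ℕ.+ k)) (proj₂ (unfilledCube (j ℕ.+ k)))) i

      corner-≤ : ∀ i j k → corner j i ≤ corner k i + width w k
      corner-≤ i j k = begin
        corner j i                           ≤⟨ proj₁ (corner-+ i j k) ⟩
        corner (k ℕ.+ j) i                   ≡⟨ ≡.cong (λ n → corner n i) (ℕ.+-comm k j) ⟩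
        corner (j ℕ.+ k) i                   ≤⟨ x≤x+w (0≤width (j ℕ.+ k)) ⟩
        corner (j ℕ.+ k) i + width w (j ℕ.+ k) ≤⟨ proj₂ (corner-+ i k j) ⟩
        corner k i + width w k               ∎
        where open ≤-Reasoning

      -- The corners increase and stay below the upper corner of each cube, so their supremum lies
      -- in all the cubes at once.
      supremum : ∀ i → ∃ (IsSup (λ x → ∃[ k ] x ≈ corner k i))
      supremum i = complete _ (corner 0 i , 0 , refl)
        (corner 0 i + width w 0 , λ { (k , x≈) → ≤-respˡ-≈ (sym x≈) (corner-≤ i k 0) })

      p : Point d
      p i = proj₁ (supremum i)

      p-lower : ∀ i k → corner k i ≤ p i
      p-lower i k = proj₁ (proj₂ (supremum i)) (k , refl)

      p-upper : ∀ i k → p i ≤ corner k i + width w k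
      p-upper i k = proj₂ (proj₂ (supremum i)) λ { (j , x≈) → ≤-respˡ-≈ (sym x≈) (corner-≤ i j k) }

      contra : ¬ (∃[ k ] Interior (B k) p)
      contra (k , p∈B) with positive-lowerBound (λ i → p i - lower (B k) i) (λ i → 0<- (proj₁ (p∈B i)))
                          | positive-lowerBound (λ i → upper (B k) i - p i) (λ i → 0<- (proj₂ (p∈B i)))
      ... | ε₁ , 0<ε₁ , ε₁≤ | ε₂ , 0<ε₂ , ε₂≤ with width-null w 0<ε₁ | width-null w 0<ε₂
      ... | k₁ , w₁<ε₁ | k₂ , w₂<ε₂ = proj₂ (unfilledCube K) (suc k , (begin
        cubeVolume d (width w K) ≈⟨ overlap-inside (corner K) (0≤width K) (B k) inside ⟩
        overlapVolume (corner K) (width w K) (B k)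
          ≤⟨ partialSum-term (λ j → overlap-nonNeg (corner K) (0≤width K) (B j)) k ⟩
        partialSum (λ j → overlapVolume (corner K) (width w K) (B j)) (suc k) ∎))
        where
        open ≤-Reasoning
        -- Widths decrease, so this level is deep enough for the distances of `p` both to the lower
        -- faces of the box (`ε₁`) and to its upper faces (`ε₂`).
        K = k₁ ℕ.+ k₂

        width-antitone : ∀ j k → width w (j ℕ.+ k) ≤ width w k
        width-antitone zero    k = ≤-refl
        width-antitone (suc j) k = ≤-trans
          (≤-by (<⇒≤ (width-pos 0<w (suc j ℕ.+ k))) (sym (halves _))) (width-antitone j k)

        wK≤ε₁ : width w K ≤ ε₁
        wK≤ε₁ = ≤-trans (≤-respˡ-≈ (reflexive (≡.cong (width w) (ℕ.+-comm k₂ k₁))) (width-antitone k₂ k₁)) (<⇒≤ w₁<ε₁)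

        wK≤ε₂ : width w K ≤ ε₂
        wK≤ε₂ = ≤-trans (width-antitone k₁ k₂) (<⇒≤ w₂<ε₂)

        inside : ∀ i → lower (B k) i ≤ corner K i × corner K i + width w K ≤ upper (B k) i
        inside i =
          ≤-by (+-nonNeg (0≤- (p-upper i K)) (0≤- (≤-trans wK≤ε₁ (ε₁≤ i))))
            (solve 4 (λ c l p w → c := l :+ (((c :+ w) :- p) :+ ((p :- l) :- w))) refl
              (corner K i) (lower (B k) i) (p i) (width w K)) ,
          ≤-by (+-nonNeg (0≤- (p-lower i K)) (0≤- (≤-trans wK≤ε₂ (ε₂≤ i))))
            (solve 4 (λ c u p w → u := (c :+ w) :+ ((p :- c) :+ ((u :- p) :- w))) refl
              (corner K i) (upper (B k) i) (p i) (width w K))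

-- Unions of open grid cells and a lower bound for the volume of their covers.

module Cells (lem : ∀ {ℓ} → ExcludedMiddle ℓ) (R : CompleteOrderedField) where

  open CompleteOrderedField R renaming (Carrier to ℝ; setoid to ℝ-setoid)
  open Extremal lem R
  open OrderedField lem R
  open Sums lem R
  open Overlaps lem R

  private variable
    d n : ℕ

  fromℕ-nonNeg : ∀ k → 0# ≤ fromℕ k
  fromℕ-nonNeg zero    = ≤-refl
  fromℕ-nonNeg (suc k) = +-nonNeg (<⇒≤ 0<1) (fromℕ-nonNeg k)

  fromℕ-mono : ∀ {j k} → j ℕ.≤ k → fromℕ j ≤ fromℕ k
  fromℕ-mono {k = k} z≤n = fromℕ-nonNeg k
  fromℕ-mono (s≤s j≤k)   = +-mono-≤ ≤-refl (fromℕ-mono j≤k)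

  *-monoʳ-≤ : ∀ {x y z} → 0# ≤ z → x ≤ y → x * z ≤ y * z
  *-monoʳ-≤ {x} {y} {z} 0≤z x≤y =
    ≤-respˡ-≈ (*-comm z x) (≤-respʳ-≈ (*-comm z y) (*-monoˡ-≤ 0≤z x≤y))

  fromℕ-suc-* : ∀ k s → fromℕ (suc k) * s ≈ fromℕ k * s + s
  fromℕ-suc-* k s = solve 2 (λ k s → (𝟙 :+ k) :* s := k :* s :+ s) refl (fromℕ k) s

  mark : ℝ → ℕ → ℝ
  mark s k = fromℕ k * s

  mark-mono : ∀ {s} → 0# ≤ s → ∀ {j k} → j ℕ.≤ k → mark s j ≤ mark s k
  mark-mono 0≤s j≤k = *-monoʳ-≤ 0≤s (fromℕ-mono j≤k)

  InCell : ℝ → ℕ → ℝ → Set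
  InCell s k x = mark s k < x × x < mark s (suc k)

  -- The closed middle half of the k-th cell begins at this point.
  inner : ℝ → ℕ → ℝ
  inner s k = mark s k + s * ½ * ½

  quarters : ∀ s → s * ½ * ½ + s * ½ + s * ½ * ½ ≈ s
  quarters s = begin
    s * ½ * ½ + s * ½ + s * ½ * ½   ≈⟨ solve 2 (λ q h → q :+ h :+ q := (q :+ q) :+ h) refl (s * ½ * ½) (s * ½) ⟩
    (s * ½ * ½ + s * ½ * ½) + s * ½ ≈⟨ +-congʳ (halves (s * ½)) ⟩
    s * ½ + s * ½                   ≈⟨ halves s ⟩
    s                               ∎
    where open SetoidReasoning ℝ-setoid

  module _ {s : ℝ} (0<s : 0# < s) where

    private
      0≤s = <⇒≤ 0<s
      0<s½ = *½-pos 0<s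
      0<s¼ = *½-pos 0<s½

    inner-InCell : ∀ k {x} → inner s k ≤ x → x ≤ inner s k + s * ½ → InCell s k x
    inner-InCell k {x} inner≤x x≤inner = <-≤-trans (<-by 0<s¼ refl) inner≤x , ≤-<-trans x≤inner (<-by 0<s¼ (begin
      mark s (suc k)                            ≈⟨ fromℕ-suc-* k s ⟩
      mark s k + s                              ≈⟨ +-congˡ (quarters s) ⟨
      mark s k + (s * ½ * ½ + s * ½ + s * ½ * ½) ≈⟨ solve 3 (λ m q h → m :+ (q :+ h :+ q) := ((m :+ q) :+ h) :+ q) refl _ _ _ ⟩
      inner s k + s * ½ + s * ½ * ½             ∎))
      where open SetoidReasoning ℝ-setoid

    -- Enlarging every middle half to its whole cell makes the intervals adjacent, and the overlaps
    -- telescope.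
    inner-overlap : ∀ n {a b} → a ≤ b →
                    Σₗ (allFin n) (λ j → overlap₁ (inner s (toℕ j)) (inner s (toℕ j) + s * ½) a b) ≤ b - a
    inner-overlap n {a} {b} a≤b = begin
      Σₗ (allFin n) (λ j → overlap₁ (inner s (toℕ j)) (inner s (toℕ j) + s * ½) a b)
        ≤⟨ Σₗ-mono (allFin n) (λ j → let below , above = inner-ends (toℕ j) in
             overlap₁-mono a≤b below (x≤x+w (<⇒≤ 0<s½)) above) ⟩
      Σₗ (allFin n) (λ j → overlap₁ (mark s (toℕ j)) (mark s (suc (toℕ j))) a b)
        ≈⟨ overlap₁-chain (mark s) (λ k → mark-mono 0≤s (ℕ.n≤1+n k)) a≤b n ⟩
      overlap₁ (mark s 0) (mark s n) a b
        ≤⟨ proj₂ (overlap₁-bounds (mark-mono 0≤s {0} {n} z≤n) a≤b) ⟩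
      b - a ∎
      where
      open ≤-Reasoning
      inner-ends : ∀ k → mark s k ≤ inner s k × inner s k + s * ½ ≤ mark s (suc k)
      inner-ends k = <⇒≤ (proj₁ (inner-InCell k ≤-refl (x≤x+w (<⇒≤ 0<s½)))) ,
                     <⇒≤ (proj₂ (inner-InCell k (x≤x+w (<⇒≤ 0<s½)) ≤-refl))

    innerCorner : Index {d} (λ _ → n) → Point d
    innerCorner c i = inner s (toℕ (c i))

    innerCubes-overlap : ∀ (B : Box d) → Σₗ (allIndices (λ _ → n)) (λ c → overlapVolume (innerCorner c) (s * ½) B) ≤ volume B
    innerCubes-overlap {d} {n} B = ≤-respˡ-≈ (sym (Σₗ-allIndices-∏ (λ _ → n) sides))
      (∏-mono (λ i → Σₗ-nonNeg (allFin n) (λ j → overlap₁-nonNeg (x≤x+w (<⇒≤ 0<s½)) (ordered B i)))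
              (λ i → inner-overlap n (ordered B i)))
      where
      sides : Fin d → Fin n → ℝ
      sides i j = overlap₁ (inner s (toℕ j)) (inner s (toℕ j) + s * ½) (lower B i) (upper B i)

    cells : Matrix {d} (λ _ → n) → Subset d
    cells A .member p = ∃[ c ] entry A c ≡ true × (∀ i → InCell s (toℕ (c i)) (p i))
    cells A .resp p≈q (c , Ac , p∈c) = c , Ac , λ i →
      <-respʳ-≈ (p≈q i) (proj₁ (p∈c i)) , <-respˡ-≈ (p≈q i) (proj₂ (p∈c i))

    cells-open : ∀ (A : Matrix {d} (λ _ → n)) → IsOpen (cells A)
    cells-open A p (c , Ac , p∈c)
      with positive-lowerBound (λ i → p i - mark s (toℕ (c i))) (λ i → 0<- (proj₁ (p∈c i)))
         | positive-lowerBound (λ i → mark s (suc (toℕ (c i))) - p i) (λ i → 0<- (proj₂ (p∈c i)))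
    ... | ε₁ , 0<ε₁ , ε₁≤ | ε₂ , 0<ε₂ , ε₂≤ = ε , 0<ε , λ q q≈p → c , Ac , λ i →
      ≤-<-trans (≤-by (0≤- (≤-trans ε≤ε₁ (ε₁≤ i))) (solve 3 (λ p m e → p :- e := m :+ ((p :- m) :- e)) refl _ _ _)) (proj₁ (q≈p i)) ,
      <-≤-trans (proj₂ (q≈p i)) (≤-by (0≤- (≤-trans ε≤ε₂ (ε₂≤ i))) (solve 3 (λ p m e → m := (p :+ e) :+ ((m :- p) :- e)) refl _ _ _))
      where
      minimum : ∃[ ε ] 0# < ε × ε ≤ ε₁ × ε ≤ ε₂
      minimum with total ε₁ ε₂
      ... | inj₁ ε₁≤ε₂ = ε₁ , 0<ε₁ , ≤-refl , ε₁≤ε₂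
      ... | inj₂ ε₂≤ε₁ = ε₂ , 0<ε₂ , ε₂≤ε₁ , ≤-refl
      ε = proj₁ minimum
      0<ε = proj₁ (proj₂ minimum)
      ε≤ε₁ = proj₁ (proj₂ (proj₂ minimum))
      ε≤ε₂ = proj₂ (proj₂ (proj₂ minimum))

    cells⊆Cube : s ≤ 1# → ∀ (A : Matrix {d} (λ _ → n)) → member (cells A) ⊆ Cube d (fromℕ n)
    cells⊆Cube {n = n} s≤1 A {p} (c , _ , p∈c) i =
      ≤-trans (*-nonNeg (fromℕ-nonNeg (toℕ (c i))) 0≤s) (<⇒≤ (proj₁ (p∈c i))) , (begin
      p i                     ≤⟨ <⇒≤ (proj₂ (p∈c i)) ⟩
      mark s (suc (toℕ (c i))) ≤⟨ mark-mono 0≤s (Fin.toℕ<n (c i)) ⟩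
      fromℕ n * s             ≤⟨ *-monoˡ-≤ (fromℕ-nonNeg n) s≤1 ⟩
      fromℕ n * 1#            ≈⟨ *-identityʳ _ ⟩
      fromℕ n                 ∎)
      where open ≤-Reasoning

    -- The cells are open, so compactness is applied to their closed middle halves instead, at the
    -- price of side `s * ½` in place of `s`. One stage `N` serves for all of them, as there are
    -- finitely many.
    cover-cells : ∀ (A : Matrix {d} (λ _ → n)) B → IsCover (cells A) B →
                  ∃[ N ] fromℕ (ones A) * cubeVolume d (s * ½) ≤ partialSum (λ k → volume (B k)) N
    cover-cells {d} {n} A B cover = N , (begin
      fromℕ (ones A) * cubeVolume d (s * ½)
        ≈⟨ Σₗ-const onesOfA _ ⟨
      Σₗ onesOfA (λ _ → cubeVolume d (s * ½))
        ≤⟨ proj₂ filled-sum ⟩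
      partialSum (λ k → Σₗ onesOfA (λ c → overlapVolume (innerCorner c) (s * ½) (B k))) N
        ≤⟨ partialSum-mono (λ k → ≤-trans
             (Σₗ-filterᵇ (entry A) (allIndices _) (λ c → overlap-nonNeg (innerCorner c) (<⇒≤ 0<s½) (B k)))
             (innerCubes-overlap (B k))) N ⟩
      partialSum (λ k → volume (B k)) N ∎)
      where
      open Covering B
      open ≤-Reasoning
      onesOfA : List (Index {d} (λ _ → n))
      onesOfA = filterᵇ (entry A) (allIndices _)

      filled : ∀ {c} → T (entry A c) → Filled (innerCorner c) (s * ½)
      filled {c} Ac = covered⇒Filled (innerCorner c) 0<s½ λ p p∈ → cover p
        (c , Equivalence.to T-≡ Ac , λ i → inner-InCell (toℕ (c i)) (proj₁ (p∈ i)) (proj₂ (p∈ i)))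

      filled-sum = Filled-sum onesOfA innerCorner (<⇒≤ 0<s½) (All.map filled (All.all-filter (T? ∘ entry A) (allIndices _)))
      N = proj₁ filled-sum

    InCell-unique : ∀ {j k x} → InCell s j x → InCell s k x → j ≡ k
    InCell-unique {j} {k} (jx , xj) (kx , xk) = ℕ.≤-antisym (le jx xk) (le kx xj)
      where
      le : ∀ {j k x} → mark s j < x → x < mark s (suc k) → j ℕ.≤ k
      le {j} {k} jx xk with j ℕ.≤? k
      ... | yes j≤k = j≤k
      ... | no  j≰k = ⊥-elim (<⇒≱ (<-trans jx xk) (mark-mono 0≤s (ℕ.≰⇒> j≰k)))

    -- An open cell of side `s` has no room for two points at distance `s`: `k ≤ j` would give y <
    -- (k + 1)s ≤ js + s < x + s.
    InCell-separated : ∀ {j k x y} → InCell s j x → InCell s k y → x + s ≤ y → j ℕ.< k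
    InCell-separated {j} {k} {x} {y} (jx , _) (_ , yk) x+s≤y with j ℕ.<? k
    ... | yes j<k = j<k
    ... | no  j≮k = ⊥-elim (<⇒≱ (<-≤-trans (≤-<-trans x+s≤y yk) (≤-trans (mark-mono 0≤s (s≤s (ℕ.≮⇒≥ j≮k)))
      (≤-reflexive (fromℕ-suc-* j s)))) (+-monoˡ-≤ s (<⇒≤ jx)))

-- Auxiliary facts on lists and Booleans.

deduplicate-AllPairs : ∀ {a ℓ₁ ℓ₂} {A : Set a} {R : Rel A ℓ₁} {S : Rel A ℓ₂} (R? : Decidable R) →
                       ∀ {xs} → AllPairs S xs → AllPairs S (deduplicate R? xs)
deduplicate-AllPairs R? []         = []
deduplicate-AllPairs R? {x ∷ _} (px ∷ pxs) =
  All.filter⁺ (¬? ∘ R? x) (All.deduplicate⁺ R? px) ∷ AllPairs.filter⁺ (¬? ∘ R? x) (deduplicate-AllPairs R? pxs)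

does-true⇒ : ∀ {p} {P : Set p} (P? : Dec P) → does P? ≡ true → P
does-true⇒ (yes p) _ = p

⇒-≤ : ∀ {a b} → (a ≡ true → b ≡ true) → a Bool.≤ b
⇒-≤ {false} {false} _  = Bool.b≤b
⇒-≤ {false} {true}  _  = Bool.f≤t
⇒-≤ {true}  a⇒b with a⇒b ≡.refl
... | ≡.refl = Bool.b≤b

true-≤ : ∀ {a b} → a Bool.≤ b → a ≡ true → b ≡ true
true-≤ Bool.b≤b a≡true = a≡true

-- Translating containment of point sets into containment of matrices, and back.

module Transfer (lem : ∀ {ℓ} → ExcludedMiddle ℓ) (R : CompleteOrderedField) where

  open CompleteOrderedField R renaming (Carrier to ℝ; setoid to ℝ-setoid)
  open Extremal lem R
  open OrderedField lem R
  open Cells lem R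

  private variable
    d n : ℕ

  differences : List ℝ → List ℝ
  differences xs = zipWith _-_ (drop 1 xs) xs

  lookup-< : ∀ {xs} → AllPairs _<_ xs → ∀ {i j} → i Fin.< j → lookup xs i < lookup xs j
  lookup-< {x ∷ xs} (px ∷ _)  {Fin.zero}  {Fin.suc j} _         = All.lookup px (∈-lookup j)
  lookup-< {x ∷ xs} (_ ∷ pxs) {Fin.suc i} {Fin.suc j} (s≤s i<j) = lookup-< pxs i<j

  lookup-<⁻ : ∀ {xs} → AllPairs _<_ xs → ∀ {i j} → lookup xs i < lookup xs j → i Fin.< j
  lookup-<⁻ {xs} inc {i} {j} xi<xj with j Fin.≤? i
  ... | no  j≰i = ℕ.≰⇒> j≰i
  ... | yes j≤i with ℕ.m≤n⇒m<n∨m≡n j≤i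
  ... | inj₁ j<i = ⊥-elim (<⇒≱ xi<xj (<⇒≤ (lookup-< inc j<i)))
  ... | inj₂ j≡i = ⊥-elim (<⇒≱ xi<xj (≤-reflexive (reflexive (≡.cong (lookup xs) (Fin.toℕ-injective j≡i)))))

  lookup-injective : ∀ {xs} → AllPairs _<_ xs → ∀ {i j} → lookup xs i ≈ lookup xs j → i ≡ j
  lookup-injective {xs} inc {i} {j} xi≈xj with Fin.<-cmp i j
  ... | Tri.tri< i<j _ _ = ⊥-elim (<⇒≱ (lookup-< inc i<j) (≤-reflexive (sym xi≈xj)))
  ... | Tri.tri≈ _ i≡j _ = i≡j
  ... | Tri.tri> _ _ j<i = ⊥-elim (<⇒≱ (lookup-< inc j<i) (≤-reflexive xi≈xj))

  -- The differences of an increasing list are positive, which discharges the premise `0# < e`. The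
  -- premise is there because `s` is chosen for a prescribed list whose entries may have any sign.
  lookup-separated : ∀ {s xs} → AllPairs _<_ xs → All (λ e → 0# < e → s ≤ e) (differences xs) →
                     ∀ {i j} → i Fin.< j → lookup xs i + s ≤ lookup xs j
  lookup-separated {s} {x ∷ y ∷ xs} ((x<y ∷ _) ∷ inc) (gap ∷ gaps) {Fin.zero} {Fin.suc j} _ = begin
    x + s                ≤⟨ ≤-by (0≤- (gap (0<- x<y))) (solve 3 (λ x y s → y := (x :+ s) :+ ((y :- x) :- s)) refl x y s) ⟩
    y                    ≤⟨ below j inc ⟩
    lookup (y ∷ xs) j    ∎
    where
    open ≤-Reasoning
    below : ∀ j → AllPairs _<_ (y ∷ xs) → y ≤ lookup (y ∷ xs) j
    below Fin.zero    _   = ≤-refl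
    below (Fin.suc j) inc = <⇒≤ (lookup-< inc {Fin.zero} {Fin.suc j} (s≤s z≤n))
  lookup-separated {s} {x ∷ []} _ _ {Fin.zero} {Fin.suc ()}
  lookup-separated {s} {x ∷ y ∷ xs} (_ ∷ inc) (_ ∷ gaps) {Fin.suc i} {Fin.suc j} (s≤s i<j) =
    lookup-separated inc gaps i<j

  -- One step along the list raises the value by at most `L` and `φ` by at least 1, hence the mark
  -- by at least `L`. Summed over the steps, differences of marks dominate differences of values;
  -- the inequality is written without subtraction.
  lookup-spread : ∀ {L xs} → 0# ≤ L → All (_≤ L) (differences xs) →
                  (φ : Fin (length xs) → ℕ) → (∀ {i j} → i Fin.< j → φ i ℕ.< φ j) →
                  ∀ {i j} → i Fin.< j → lookup xs j + mark L (φ i) ≤ lookup xs i + mark L (φ j)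
  lookup-spread {L} {x ∷ y ∷ xs} 0≤L (gap ∷ gaps) φ φ-inc {Fin.zero} {Fin.suc Fin.zero} _ = begin
    y + mark L (φ Fin.zero)
      ≤⟨ ≤-by (0≤- gap) (solve 4 (λ x y l m → x :+ (m :+ l) := (y :+ m) :+ (l :- (y :- x))) refl x y L _) ⟩
    x + (mark L (φ Fin.zero) + L)
      ≈⟨ +-congˡ (fromℕ-suc-* (φ Fin.zero) L) ⟨
    x + mark L (suc (φ Fin.zero))
      ≤⟨ +-mono-≤ ≤-refl (mark-mono 0≤L (φ-inc (s≤s z≤n))) ⟩
    x + mark L (φ (Fin.suc Fin.zero)) ∎
    where open ≤-Reasoning
  lookup-spread {L} {x ∷ y ∷ xs} 0≤L (gap ∷ gaps) φ φ-inc {Fin.zero} {Fin.suc (Fin.suc j)} _ =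
    ≤-by (+-nonNeg
      (0≤- (lookup-spread {xs = x ∷ y ∷ xs} 0≤L (gap ∷ gaps) φ φ-inc {Fin.zero} {Fin.suc Fin.zero} (s≤s z≤n)))
      (0≤- (lookup-spread {xs = y ∷ xs} 0≤L gaps (φ ∘ Fin.suc) (λ i<j → φ-inc (s≤s i<j)) {Fin.zero} {Fin.suc j} (s≤s z≤n))))
      (solve 6 (λ x y z a b c → x :+ c := (z :+ a) :+ (((x :+ b) :- (y :+ a)) :+ ((y :+ c) :- (z :+ b)))) refl
        x y (lookup xs j) (mark L (φ Fin.zero)) (mark L (φ (Fin.suc Fin.zero))) (mark L (φ (Fin.suc (Fin.suc j)))))
  lookup-spread {L} {x ∷ y ∷ xs} 0≤L (gap ∷ gaps) φ φ-inc {Fin.suc i} {Fin.suc j} (s≤s i<j) =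
    lookup-spread {xs = y ∷ xs} 0≤L gaps (φ ∘ Fin.suc) (λ i<j → φ-inc (s≤s i<j)) i<j

  module _ (P : Subset d) (fin : Finite P) (i : Fin d) where

    private
      open DecTotalOrder ℝ-decTotalOrder using () renaming (_≟_ to _≈?_)
      open Sort ℝ-decTotalOrder using (sort; sort-↗; sort-↭)
      coordinates = map (λ p → p i) (proj₁ fin)

    -- Strict order is by definition `≤` together with `≉`: sorting yields the first, removal of
    -- duplicates the second.
    values-increasing : AllPairs _<_ (values P fin i)
    values-increasing = AllPairs.zip
      (deduplicate-AllPairs _≈?_ (Linked.Linked⇒AllPairs ≤-trans (sort-↗ coordinates)) ,
       Unique.deduplicate-! (DecTotalOrder.Eq.decSetoid ℝ-decTotalOrder) (sort coordinates))

    values-Coord : ∀ j → Coord P i (lookup (values P fin i) j)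
    values-Coord j = All.lookup {P = Coord P i} (All.deduplicate⁺ _≈?_ (↭.All-resp-↭ (↭-sym (sort-↭ coordinates))
      (All.map⁺ (All.tabulate λ {p} p∈ → p , Equivalence.from (proj₂ fin p)
        (Any.map (λ { ≡.refl _ → refl }) p∈) , refl)))) (∈-lookup j)

    values-index : ∀ {x} → Coord P i x → ∃[ j ] lookup (values P fin i) j ≈ x
    values-index {x} (p , p∈P , pi≈x) = Any.index found , sym (Any.lookup-index found)
      where
      found : Any (x ≈_) (values P fin i)
      found = Any.deduplicate⁺ _≈?_ (λ y≈z x≈z → trans x≈z (sym y≈z))
        (↭.Any-resp-↭ (↭-sym (sort-↭ coordinates))
          (Any.map⁺ (Any.map (λ p≈q → trans (sym pi≈x) (p≈q i)) (Equivalence.to (proj₂ fin p) p∈P))))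

  module _ (P : Subset d) (fin : Finite P) where

    M-true⇒ : ∀ {x} → entry M[ P , fin ] x ≡ true → (λ i → lookup (values P fin i) (x i)) ∈ member P
    M-true⇒ = does-true⇒ lem

    M-true : ∀ {x} → (λ i → lookup (values P fin i) (x i)) ∈ member P → entry M[ P , fin ] x ≡ true
    M-true = dec-true lem

    -- An embedding of P sends distinct values to coordinates at distance at least `s`, hence into
    -- different cells in the right order. The numbers of these cells select a copy of the matrix of
    -- P in `A`.
    cells-free : ∀ {s} (0<s : 0# < s) → (∀ i → All (λ e → 0# < e → s ≤ e) (gaps P fin i)) →
                 (A : Matrix (λ _ → n)) → MatrixFree M[ P , fin ] A → Free P (cells 0<s A)
    cells-free {n} {s} 0<s separated A free (f , expand , f-P) = free (φ , φ-inc , φ-A)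
      where
      vs : ∀ i → List ℝ
      vs = values P fin

      image : ∀ i → Fin (length (vs i)) → ℝ
      image i j = proj₁ (Func.to (f i) (lookup (vs i) j , values-Coord P fin i j))

      -- The coordinate comes with some point of the union that has it, not with the image of a
      -- point of P. Its cell number depends on the coordinate alone, and `φ-A` uses this by way of
      -- `InCell-unique`.
      cell : ∀ i j → ∃[ k ] InCell s (toℕ {n} k) (image i j)
      cell i j = let q , (c , _ , q∈c) , qi≈ = proj₂ (Func.to (f i) (lookup (vs i) j , values-Coord P fin i j)) in
        c i , <-respʳ-≈ qi≈ (proj₁ (q∈c i)) , <-respˡ-≈ qi≈ (proj₂ (q∈c i))

      φ : ∀ i → Fin (length (vs i)) → Fin n
      φ i j = proj₁ (cell i j)

      image-separated : ∀ i {j k} → j Fin.< k → image i j + s ≤ image i k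
      image-separated i {j} {k} j<k = ≤-by
        (+-nonNeg (0≤- (1≤/⇒≤ (0<- vj<vk) (expand i (_ , values-Coord P fin i k) (_ , values-Coord P fin i j) vj<vk)))
                  (0≤- (lookup-separated (values-increasing P fin i) (separated i) j<k)))
        (solve 5 (λ a b v w s → b := (a :+ s) :+ (((b :- a) :- (w :- v)) :+ (w :- (v :+ s)))) refl
          (image i j) (image i k) (lookup (vs i) j) (lookup (vs i) k) s)
        where vj<vk = lookup-< (values-increasing P fin i) j<k

      φ-inc : ∀ i → StrictlyIncreasing (φ i)
      φ-inc i {j} {k} j<k = InCell-separated 0<s (proj₂ (cell i j)) (proj₂ (cell i k)) (image-separated i j<k)

      φ-A : M[ P , fin ] ≤ᴹ submatrix A φ
      φ-A x = ⇒-≤ λ Mx → let p∈P = M-true⇒ Mx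
                             c , Ac , p∈c = f-P _ p∈P
        in ≡.trans (entry-cong A λ i → Fin.toℕ-injective (InCell-unique 0<s
             (proj₂ (cell i (x i)))
             -- The same value occurs with two different proofs that it is a coordinate of P, and
             -- only `Func.cong` relates its two images.
             (let same = Func.cong (f i) {_ , (λ i → lookup (vs i) (x i)) , p∈P , refl} {_ , values-Coord P fin i (x i)} refl
              in <-respʳ-≈ same (proj₁ (p∈c i)) , <-respˡ-≈ same (proj₂ (p∈c i))))) Ac

    samples : (S : Subset d) (L : ℝ) → Point d → ∀ n → Matrix {d} (λ _ → n)
    samples S L t n .entry c = does (lem {P = (λ i → t i + mark L (toℕ (c i))) ∈ member S})
    samples S L t n .entry-cong {c} {c′} c≗c′ = does-⇔ (mk⇔
      (resp S (λ i → reflexive (≡.cong (λ k → t i + mark L (toℕ k)) (c≗c′ i))))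
      (resp S (λ i → reflexive (≡.cong (λ k → t i + mark L (toℕ k)) (≡.sym (c≗c′ i)))))) lem lem

    -- Given a copy of the matrix of P at the indices `φ`, the j-th value in direction i is sent to
    -- the grid coordinate of index `φ i j`; by `lookup-spread` no difference of values shrinks.
    samples-free : ∀ {L} → 0# ≤ L → (∀ i → All (_≤ L) (gaps P fin i)) → (S : Subset d) → Free P S →
                   ∀ t n → MatrixFree M[ P , fin ] (samples S L t n)
    samples-free {L} 0≤L spread S free t n (φ , φ-inc , φ-A) = free (f , expand , f-P)
      where
      vs : ∀ i → List ℝ
      vs = values P fin

      index : ∀ i → ∃ (Coord P i) → Fin (length (vs i))
      index i (_ , x∈) = proj₁ (values-index P fin i x∈)

      lookup-index : ∀ i x → lookup (vs i) (index i x) ≈ proj₁ x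
      lookup-index i (_ , x∈) = proj₂ (values-index P fin i x∈)

      image : ∀ i → Fin (length (vs i)) → ℝ
      image i j = t i + mark L (toℕ (φ i j))

      image-member : ∀ x → (λ i → lookup (vs i) (x i)) ∈ member P → (λ i → image i (x i)) ∈ member S
      image-member x x∈P = does-true⇒ lem (true-≤ (φ-A x) (M-true x∈P))

      indices-member : ∀ p (p∈P : p ∈ member P) →
                       (λ i → image i (index i (p i , p , p∈P , refl))) ∈ member S
      indices-member p p∈P = image-member _ (resp P (λ i → sym (lookup-index i (p i , p , p∈P , refl))) p∈P)

      index-cong : ∀ i {x y} → proj₁ x ≈ proj₁ y → index i x ≡ index i y
      index-cong i {x} {y} x≈y = lookup-injective (values-increasing P fin i)
        (trans (lookup-index i x) (trans x≈y (sym (lookup-index i y))))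

      -- A coordinate alone yields no point of `S`; the point `p` realising it does, and
      -- `index-cong` identifies the index found for `p i` with the one found for `x`.
      image-Coord : ∀ i x → Coord S i (image i (index i x))
      image-Coord i x@(_ , p , p∈P , pi≈x) = _ , indices-member p p∈P ,
        reflexive (≡.cong (image i) (index-cong i {_} {x} pi≈x))

      f : ∀ i → Func (CoordSetoid P i) (CoordSetoid S i)
      f i .Func.to x = image i (index i x) , image-Coord i x
      f i .Func.cong {x} {y} x≈y = reflexive (≡.cong (image i) (index-cong i {x} {y} x≈y))

      expand : ∀ i (x x′ : ∃ (Coord P i)) → proj₁ x′ < proj₁ x →
               1# ≤ (image i (index i x) - image i (index i x′)) / (proj₁ x - proj₁ x′)
      expand i x x′ x′<x = ≤⇒1≤/ (0<- x′<x) (begin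
        proj₁ x - proj₁ x′
          ≈⟨ +-cong (lookup-index i x) (-‿cong (lookup-index i x′)) ⟨
        lookup (vs i) (index i x) - lookup (vs i) (index i x′)
          ≤⟨ ≤-by (0≤- (lookup-spread 0≤L (spread i) (toℕ ∘ φ i) (φ-inc i) j′<j))
               (solve 5 (λ v w a b t → (t :+ b) :- (t :+ a) := (w :- v) :+ ((v :+ b) :- (w :+ a))) refl
                 (lookup (vs i) (index i x′)) (lookup (vs i) (index i x)) _ _ _) ⟩
        image i (index i x) - image i (index i x′) ∎)
        where
        open ≤-Reasoning
        j′<j : index i x′ Fin.< index i x
        j′<j = lookup-<⁻ (values-increasing P fin i)
          (<-respˡ-≈ (sym (lookup-index i x′)) (<-respʳ-≈ (sym (lookup-index i x)) x′<x))

      f-P : ∀ p (p∈P : p ∈ member P) → (λ i → proj₁ (Func.to (f i) (p i , p , p∈P , refl))) ∈ member S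
      f-P = indices-member

-- Enumerating multi-indices and sequences of lists.

-- Without function extensionality, `x` itself need not be listed, only a pointwise equal index.
allIndices-complete : ∀ {d} {n : Fin d → ℕ} (x : Index n) → ∃[ y ] y ∈ₗ allIndices n × (∀ i → y i ≡ x i)
allIndices-complete {zero}  x = _ , here ≡.refl , λ ()
allIndices-complete {suc d} {n} x with allIndices-complete (λ i → x (Fin.suc i))
... | y , y∈ , y≗x = cons (x Fin.zero) y ,
  ∈-concatMap⁺ (λ j → map (cons j) (allIndices (λ i → n (Fin.suc i))))
    (Any.map (λ { ≡.refl → ∈-map⁺ (cons (x Fin.zero)) y∈ }) (∈-allFin (x Fin.zero))) ,
  λ { Fin.zero → ≡.refl ; (Fin.suc i) → y≗x i }
  where
  cons : Fin (n Fin.zero) → Index (λ i → n (Fin.suc i)) → Index n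
  cons = Fin.∀-cons {P = λ i → Fin (n i)}

module _ {A : Set} (idle : A) where

  -- Exhausted queues are refilled from the next level; the idle element is listed
  -- at each refill, so that empty levels cause no difficulty.
  enumerate : (ℕ → List A) → List A → ℕ → A
  enumerate levels (x ∷ queue) zero    = x
  enumerate levels (x ∷ queue) (suc n) = enumerate levels queue n
  enumerate levels []          zero    = idle
  enumerate levels []          (suc n) = enumerate (levels ∘ suc) (levels 0) n

  enumerate-queue : ∀ {levels queue x} → x ∈ₗ queue → ∃[ n ] enumerate levels queue n ≡ x
  enumerate-queue (here ≡.refl) = 0 , ≡.refl
  enumerate-queue (there x∈)    = let n , eq = enumerate-queue x∈ in suc n , eq

  enumerate-levels : ∀ levels queue k {x} → x ∈ₗ levels k → ∃[ n ] enumerate levels queue n ≡ x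
  enumerate-levels levels (_ ∷ queue) k       x∈ = let n , eq = enumerate-levels levels queue k x∈ in suc n , eq
  enumerate-levels levels []          zero    x∈ = let n , eq = enumerate-queue x∈ in suc n , eq
  enumerate-levels levels []          (suc k) x∈ =
    let n , eq = enumerate-levels (levels ∘ suc) (levels 0) k x∈ in suc n , eq

-- An economical cover of an open set.

module Decomposition (lem : ∀ {ℓ} → ExcludedMiddle ℓ) (R : CompleteOrderedField) where

  open CompleteOrderedField R renaming (Carrier to ℝ; setoid to ℝ-setoid)
  open Extremal lem R
  open OrderedField lem R
  open Sums lem R
  open Overlaps lem R
  open Cells lem R
  open Transfer lem R

  private variable
    d n : ℕ

  -- Each refill uses up a step at the idle element, which contributes nothing; so `n` steps fetch
  -- at most the first `n` levels.
  enumerate-sum : ∀ {A : Set} {idle : A} (v : A → ℝ) → v idle ≈ 0# → (∀ x → 0# ≤ v x) →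
                  ∀ levels queue n → partialSum (v ∘ enumerate idle levels queue) n ≤
                                     Σₗ queue v + partialSum (λ k → Σₗ (levels k) v) n
  enumerate-sum v v0 0≤v levels queue zero = +-nonNeg (Σₗ-nonNeg queue 0≤v) ≤-refl
  enumerate-sum {idle = idle} v v0 0≤v levels (x ∷ queue) (suc n) = begin
    v x + partialSum (v ∘ enumerate idle levels queue) n
      ≤⟨ +-mono-≤ ≤-refl (enumerate-sum v v0 0≤v levels queue n) ⟩
    v x + (Σₗ queue v + partialSum (λ k → Σₗ (levels k) v) n)
      ≈⟨ +-assoc _ _ _ ⟨
    Σₗ (x ∷ queue) v + partialSum (λ k → Σₗ (levels k) v) n
      ≤⟨ +-mono-≤ ≤-refl (partialSum-monoʳ (λ k → Σₗ-nonNeg (levels k) 0≤v) (ℕ.n≤1+n n)) ⟩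
    Σₗ (x ∷ queue) v + partialSum (λ k → Σₗ (levels k) v) (suc n) ∎
    where open ≤-Reasoning
  enumerate-sum v v0 0≤v levels [] (suc n) =
    +-mono-≤ (≤-reflexive v0) (enumerate-sum v v0 0≤v (levels ∘ suc) (levels 0) n)

  triple : ℝ → ℝ
  triple w = w + w + w

  -- Covers consist of interiors, hence a margin around the closed cube. A margin proportional to
  -- the side lets the cost scale like the volume under bisection; it accounts for the factor 3ᵈ in
  -- the upper constant.
  tripled : Point d → ∀ {w} → 0# ≤ w → Box d
  tripled l {w} 0≤w = record
    { lower   = λ i → l i - w
    ; upper   = λ i → l i + w + w
    ; ordered = λ i → ≤-by (+-nonNeg (+-nonNeg 0≤w 0≤w) 0≤w)
        (solve 2 (λ l w → l :+ w :+ w := (l :- w) :+ (w :+ w :+ w)) refl (l i) w)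
    }

  tripled-volume : ∀ (l : Point d) {w} (0≤w : 0# ≤ w) → volume (tripled l 0≤w) ≈ cubeVolume d (triple w)
  tripled-volume l {w} 0≤w = ∏-cong λ i →
    solve 2 (λ l w → (l :+ w :+ w) :- (l :- w) := w :+ w :+ w) refl (l i) w

  InCube⇒Interior-tripled : ∀ {l p : Point d} {w} (0<w : 0# < w) → InCube l w p → Interior (tripled l (<⇒≤ 0<w)) p
  InCube⇒Interior-tripled {l = l} {w = w} 0<w p∈ i =
    <-≤-trans (<-by 0<w (solve 2 (λ l w → l := (l :- w) :+ w) refl (l i) w)) (proj₁ (p∈ i)) ,
    ≤-<-trans (proj₂ (p∈ i)) (<-by 0<w refl)

  degenerate : Box d
  degenerate = record { lower = λ _ → 0# ; upper = λ _ → 0# ; ordered = λ _ → ≤-refl }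

  -- In dimension 0 the volume would be the empty product 1.
  degenerate-volume : .{{_ : NonZero d}} → volume (degenerate {d}) ≈ 0#
  degenerate-volume {suc d} = trans (*-congʳ (-‿inverseʳ 0#)) (zeroˡ _)

  volume-nonNeg : ∀ (B : Box d) → 0# ≤ volume B
  volume-nonNeg B = ∏-nonNeg (λ i → 0≤- (ordered B i))

  triple-half : ∀ w → triple (w * ½) ≈ triple w * ½
  triple-half w = solve 2 (λ w h → w :* h :+ w :* h :+ w :* h := (w :+ w :+ w) :* h) refl w ½

  partialSums-bounded⇒IsSum : ∀ a {u} → (∀ N → partialSum a N ≤ u) → ∃[ t ] IsSum a t × t ≤ u
  partialSums-bounded⇒IsSum a {u} sums≤u = t , t-sup , proj₂ t-sup bounded
    where
    bounded : UpperBound (λ x → ∃[ N ] x ≈ partialSum a N) u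
    bounded (N , x≈) = ≤-respˡ-≈ (sym x≈) (sums≤u N)
    supremum = complete (λ x → ∃[ N ] x ≈ partialSum a N) (0# , 0 , refl) (u , bounded)
    t = proj₁ supremum
    t-sup = proj₂ supremum

  nearest-mark : ∀ L n {x} → 0# ≤ x → x ≤ mark L (suc n) → ∃[ k ] k ℕ.≤ n × mark L k ≤ x × x ≤ mark L (suc k)
  nearest-mark L zero    {x} 0≤x x≤ = 0 , z≤n , ≤-respˡ-≈ (sym (zeroˡ L)) 0≤x , x≤
  nearest-mark L (suc n) {x} 0≤x x≤ with total x (mark L (suc n))
  ... | inj₁ x≤′ = let k , k≤n , between = nearest-mark L n 0≤x x≤′ in k , ℕ.m≤n⇒m≤1+n k≤n , between
  ... | inj₂ ≤x  = suc n , ℕ.≤-refl , ≤x , x≤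

  -- Dyadic bookkeeping for the translates of S.

  module _ (S : Subset d) {L : ℝ} (0<L : 0# < L) (n : ℕ) where

    private
      0<wd : ∀ k → 0# < width L k
      0<wd = width-pos 0<L

      0≤wd : ∀ k → 0# ≤ width L k
      0≤wd k = <⇒≤ (0<wd k)

    translate : Index {d} (λ _ → n) → Point d → Point d
    translate c t i = t i + mark L (toℕ (c i))

    Inside : Point d → ℝ → Index {d} (λ _ → n) → Set
    Inside l w c = ∀ t → InCube l w t → translate c t ∈ member S

    inside : Point d → ℝ → Index {d} (λ _ → n) → Bool
    inside l w c = does (lem {P = Inside l w c})

    hit : Point d → Index {d} (λ _ → n) → Bool
    hit t c = does (lem {P = translate c t ∈ member S})

    hits : List (Index {d} (λ _ → n)) → Point d → ℕ
    hits cs t = length (filterᵇ (hit t) cs)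

    -- An index whose translate of the cube lies in S is hit by every point of the cube, hence by
    -- `t`.
    hits-split : ∀ {l w t} → InCube l w t → ∀ cs →
                 hits cs t ≡ length (filterᵇ (inside l w) cs) ℕ.+ hits (filterᵇ (not ∘ inside l w) cs) t
    hits-split t∈ [] = ≡.refl
    hits-split {l} {w} {t} t∈ (c ∷ cs) with lem {P = Inside l w c}
    ... | yes c-inside rewrite dec-true (lem {P = translate c t ∈ member S}) (c-inside t t∈) =
      ≡.cong suc (hits-split t∈ cs)
    ... | no  _ with hit t c
    ...   | true  = ≡.trans (≡.cong suc (hits-split t∈ cs)) (≡.sym (ℕ.+-suc _ _))
    ...   | false = hits-split t∈ cs

    -- A dyadic cube together with the indices c for which no cube containing it
    -- has been found whose translate by c lies in S.  The budget bounds the number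
    -- of these translates which S still has to offer at any point of the cube.
    record Node (k : ℕ) : Set where
      field
        corner  : Point d
        pending : List (Index {d} (λ _ → n))
        budget  : ℕ
        hits≤   : ∀ t → InCube corner (width L k) t → hits pending t ℕ.≤ budget

      finished : List (Index {d} (λ _ → n))
      finished = filterᵇ (inside corner (width L k)) pending

      remaining : List (Index {d} (λ _ → n))
      remaining = filterᵇ (not ∘ inside corner (width L k)) pending

      split≤ : ∀ t → InCube corner (width L k) t → hits remaining t ℕ.+ length finished ℕ.≤ budget
      split≤ t t∈ = ≡.subst (ℕ._≤ budget) (≡.trans (hits-split t∈ pending) (ℕ.+-comm (length finished) (hits remaining t))) (hits≤ t t∈)

      finished≤ : length finished ℕ.≤ budget
      -- Any point of the cube would do as a witness; the corner is at hand.
      finished≤ = ℕ.m+n≤o⇒n≤o _ (split≤ corner λ i → ≤-refl , x≤x+w (0≤wd k))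

      boxOf : Index {d} (λ _ → n) → Box d
      boxOf c = tripled (translate c corner) (0≤wd k)

      boxes : List (Box d)
      boxes = map boxOf finished

      childNode : Index {d} (λ _ → 2) → Node (suc k)
      childNode b = record
        { corner  = child corner (width L (suc k)) b
        ; pending = remaining
        -- Each finished index accounts for one hit at every point of the cube, so only the
        -- difference is left for the remaining ones.
        ; budget  = budget ℕ.∸ length finished
        ; hits≤   = λ t t∈ → ℕ.m+n≤o⇒m≤o∸n _ (split≤ t λ i →
            ≤-trans (shift-lower (b i) (0≤wd (suc k))) (proj₁ (t∈ i)) ,
            ≤-trans (proj₂ (t∈ i)) (shift-upper (b i) (0≤wd k)))
        }

      children : List (Node (suc k))
      children = map childNode (allIndices (two {d}))

    open Node

    cost : ℕ → ℝ
    cost k = cubeVolume d (triple (width L k))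

    -- The price of boxing as many translates of this cube as the budget allows.
    potential : ∀ {k} → Node k → ℝ
    potential {k} ν = fromℕ (budget ν) * cost k

    potential-nonNeg : ∀ {k} (ν : Node k) → 0# ≤ potential ν
    potential-nonNeg {k} ν = *-nonNeg (fromℕ-nonNeg (budget ν))
      (∏-nonNeg {d} (λ _ → +-nonNeg (+-nonNeg (0≤wd k) (0≤wd k)) (0≤wd k)))

    -- Each finished index takes one unit of the budget at the price `cost k`. The rest is inherited
    -- in full by all 2ᵈ children, whose cubes cost 2ᵈ times less.
    potential-split : ∀ {k} (ν : Node k) → Σₗ (boxes ν) volume + Σₗ (children ν) potential ≈ potential ν
    potential-split {k} ν = begin
      Σₗ (boxes ν) volume + Σₗ (children ν) potential
        ≈⟨ +-cong boxes-sum children-sum ⟩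
      fromℕ g * cost k + fromℕ (budget ν ℕ.∸ g) * cost k
        ≈⟨ distribʳ _ _ _ ⟨
      (fromℕ g + fromℕ (budget ν ℕ.∸ g)) * cost k
        ≈⟨ *-congʳ (MonoidMult.×-homo-+ +-monoid 1# g (budget ν ℕ.∸ g)) ⟨
      fromℕ (g ℕ.+ (budget ν ℕ.∸ g)) * cost k
        ≡⟨ ≡.cong (λ m → fromℕ m * cost k) (ℕ.m+[n∸m]≡n (finished≤ ν)) ⟩
      potential ν ∎
      where
      open SetoidReasoning ℝ-setoid
      g = length (finished ν)

      boxes-sum : Σₗ (boxes ν) volume ≈ fromℕ g * cost k
      boxes-sum = begin
        Σₗ (boxes ν) volume                          ≡⟨ Σₗ-map (boxOf ν) (finished ν) volume ⟩
        Σₗ (finished ν) (λ c → volume (boxOf ν c))   ≈⟨ Σₗ-cong (finished ν) (λ c → tripled-volume (translate c (corner ν)) (0≤wd k)) ⟩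
        Σₗ (finished ν) (λ _ → cost k)               ≈⟨ Σₗ-const (finished ν) (cost k) ⟩
        fromℕ g * cost k                             ∎

      children-sum : Σₗ (children ν) potential ≈ fromℕ (budget ν ℕ.∸ g) * cost k
      children-sum = begin
        Σₗ (children ν) potential
          ≡⟨ Σₗ-map (childNode ν) (allIndices (two {d})) potential ⟩
        Σₗ (allIndices (two {d})) (λ _ → fromℕ (budget ν ℕ.∸ g) * cost (suc k))
          ≈⟨ Σₗ-*ˡ (allIndices (two {d})) _ _ ⟩
        fromℕ (budget ν ℕ.∸ g) * Σₗ (allIndices (two {d})) (λ _ → cost (suc k))
          ≈⟨ *-congˡ (Σₗ-cong (allIndices (two {d})) (λ _ → ∏-cong {d} (λ _ → triple-half (width L k)))) ⟩
        fromℕ (budget ν ℕ.∸ g) * Σₗ (allIndices (two {d})) (λ _ → cubeVolume d (triple (width L k) * ½))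
          ≈⟨ *-congˡ (children-volume d (triple (width L k))) ⟩
        fromℕ (budget ν ℕ.∸ g) * cost k ∎

    module _ (root : Node 0) where

      level : ∀ k → List (Node k)
      level zero    = root ∷ []
      level (suc k) = concatMap children (level k)

      boxLevel : ℕ → List (Box d)
      boxLevel k = concatMap boxes (level k)

      level-sum : ∀ k → Σₗ (boxLevel k) volume + Σₗ (level (suc k)) potential ≈ Σₗ (level k) potential
      level-sum k = begin
        Σₗ (boxLevel k) volume + Σₗ (level (suc k)) potential
          ≈⟨ +-cong (Σₗ-concatMap boxes (level k) volume) (Σₗ-concatMap children (level k) potential) ⟩
        Σₗ (level k) (λ ν → Σₗ (boxes ν) volume) + Σₗ (level k) (λ ν → Σₗ (children ν) potential)
          ≈⟨ Σₗ-+ (level k) _ _ ⟨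
        Σₗ (level k) (λ ν → Σₗ (boxes ν) volume + Σₗ (children ν) potential)
          ≈⟨ Σₗ-cong (level k) potential-split ⟩
        Σₗ (level k) potential ∎
        where open SetoidReasoning ℝ-setoid

      -- Telescoping `level-sum`: what the boxes of the first levels cost is taken from the
      -- potential of the root, and what is left is nonnegative.
      boxLevels-sum : ∀ K → partialSum (λ k → Σₗ (boxLevel k) volume) K ≤ potential root
      boxLevels-sum K = ≤-respʳ-≈ (+-identityʳ _) (≤-respˡ-≈ (partialSum-cong
        (λ j → reflexive (≡.cong (λ m → Σₗ (boxLevel m) volume) (ℕ.+-identityʳ j))) K) (from 0 K))
        where
        open ≤-Reasoning
        from : ∀ k K → partialSum (λ j → Σₗ (boxLevel (j ℕ.+ k)) volume) K ≤ Σₗ (level k) potential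
        from k zero    = Σₗ-nonNeg (level k) potential-nonNeg
        from k (suc K) = begin
          Σₗ (boxLevel k) volume + partialSum (λ j → Σₗ (boxLevel (suc j ℕ.+ k)) volume) K
            ≈⟨ +-congˡ (partialSum-cong (λ j → reflexive (≡.cong (λ m → Σₗ (boxLevel m) volume) (≡.sym (ℕ.+-suc j k)))) K) ⟩
          Σₗ (boxLevel k) volume + partialSum (λ j → Σₗ (boxLevel (j ℕ.+ suc k)) volume) K
            ≤⟨ +-mono-≤ ≤-refl (from (suc k) K) ⟩
          Σₗ (boxLevel k) volume + Σₗ (level (suc k)) potential
            ≈⟨ level-sum k ⟩
          Σₗ (level k) potential ∎

      -- Every dyadic cube around a translate of p is finished once its side is
      -- less than the radius ε of a neighbourhood of p in S.
      module _ {p : Point d} {ε} (near : ∀ q → (∀ i → p i - ε < q i × q i < p i + ε) → q ∈ member S) where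

        descend : ∀ {j k K} → k ℕ.+ j ≡ K → width L K < ε → ∀ {ν : Node k} → ν ∈ₗ level k →
                  ∀ {c} → c ∈ₗ pending ν → ∀ t → InCube (corner ν) (width L k) t → (∀ i → translate c t i ≈ p i) →
                  ∃[ k′ ] ∃[ B ] B ∈ₗ boxLevel k′ × Interior B p
        descend {j} {k} {K} k+j≡K wK<ε {ν} ν∈ {c} c∈ t t∈ t≈p = cases (inside (corner ν) (width L k) c) ≡.refl
          where
          Goal = ∃[ k′ ] ∃[ B ] B ∈ₗ boxLevel k′ × Interior B p

          done : inside (corner ν) (width L k) c ≡ true → Goal
          done eq = k , boxOf ν c ,
            ∈-concatMap⁺ boxes (Any.map (λ { ≡.refl → ∈-map⁺ (boxOf ν)
              (∈-filter⁺ (T? ∘ inside (corner ν) (width L k)) c∈ (≡.subst T (≡.sym eq) tt)) }) ν∈) ,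
            InCube⇒Interior-tripled (0<wd k) λ i →
              ≤-respʳ-≈ (t≈p i) (+-monoˡ-≤ _ (proj₁ (t∈ i))) ,
              ≤-respˡ-≈ (t≈p i) (≤-trans (+-monoˡ-≤ _ (proj₂ (t∈ i)))
                (≤-reflexive (solve 3 (λ l w m → (l :+ w) :+ m := (l :+ m) :+ w) refl
                  (corner ν i) (width L k) (mark L (toℕ (c i))))))

          half : ∀ i → ∃[ b ] shift b (width L (suc k)) (corner ν i) ≤ t i ×
                              t i ≤ shift b (width L (suc k)) (corner ν i) + width L (suc k)
          half i with total (t i) (corner ν i + width L (suc k))
          ... | inj₁ t≤m = Fin.zero , proj₁ (t∈ i) , t≤m
          ... | inj₂ m≤t = Fin.suc Fin.zero , m≤t , ≤-trans (proj₂ (t∈ i))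
            (≤-reflexive (trans (+-congˡ (sym (halves (width L k)))) (sym (+-assoc _ _ _))))

          listed = allIndices-complete {n = two {d}} (λ i → proj₁ (half i))
          b = proj₁ listed

          t∈child : InCube (child (corner ν) (width L (suc k)) b) (width L (suc k)) t
          t∈child i = ≡.subst
            (λ e → shift e (width L (suc k)) (corner ν i) ≤ t i × t i ≤ shift e (width L (suc k)) (corner ν i) + width L (suc k))
            (≡.sym (proj₂ (proj₂ listed) i)) (proj₂ (half i))

          -- Points of one cube differ by at most its side in each coordinate, so the translate of
          -- the cube stays in the ε-neighbourhood of `p`.
          inside-small : width L k < ε → Inside (corner ν) (width L k) c
          inside-small w<ε u u∈ = near (translate c u) λ i →
            <-by (+-pos-nonNeg (0<- w<ε) (+-nonNeg (0≤- (proj₁ (u∈ i))) (0≤- (proj₂ (t∈ i))))) (begin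
              u i + m i
                ≈⟨ solve 6 (λ l w e t u m → u :+ m := ((t :+ m) :- e) :+ ((e :- w) :+ ((u :- l) :+ ((l :+ w) :- t)))) refl
                     (corner ν i) (width L k) ε (t i) (u i) (m i) ⟩
              ((t i + m i) - ε) + _
                ≈⟨ +-congʳ (+-congʳ (t≈p i)) ⟩
              (p i - ε) + _ ∎) ,
            <-by (+-pos-nonNeg (0<- w<ε) (+-nonNeg (0≤- (proj₁ (t∈ i))) (0≤- (proj₂ (u∈ i))))) (begin
              p i + ε
                ≈⟨ +-congʳ (t≈p i) ⟨
              (t i + m i) + ε
                ≈⟨ solve 6 (λ l w e t u m → (t :+ m) :+ e := (u :+ m) :+ ((e :- w) :+ ((t :- l) :+ ((l :+ w) :- u)))) refl
                     (corner ν i) (width L k) ε (t i) (u i) (m i) ⟩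
              (u i + m i) + _ ∎)
            where
            open SetoidReasoning ℝ-setoid
            m : Fin d → ℝ
            m i = mark L (toℕ (c i))

          -- The counter `j` of levels left before `K` makes the descent terminate: at level `K` the
          -- cube is small enough for `c` to be inside.
          deeper : inside (corner ν) (width L k) c ≡ false → ∀ j → k ℕ.+ j ≡ K → Goal
          deeper eq zero    k+0≡K = ⊥-elim (true≢false (≡.trans (≡.sym (dec-true lem (inside-small
            (≡.subst (λ m → width L m < ε) (≡.trans (≡.sym k+0≡K) (ℕ.+-identityʳ k)) wK<ε)))) eq))
            where
            true≢false : ¬ true ≡ false
            true≢false ()
          deeper eq (suc j) k+j≡K = descend {j} {suc k} (≡.trans (≡.sym (ℕ.+-suc k j)) k+j≡K) wK<ε
            (∈-concatMap⁺ children (Any.map (λ { ≡.refl → ∈-map⁺ (childNode ν) (proj₁ (proj₂ listed)) }) ν∈))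
            (∈-filter⁺ (T? ∘ not ∘ inside (corner ν) (width L k)) c∈ (≡.subst (T ∘ not) (≡.sym eq) tt))
            t t∈child t≈p

          cases : ∀ e → inside (corner ν) (width L k) c ≡ e → Goal
          cases true  eq = done eq
          cases false eq = deeper eq j k+j≡K

    open-cover : .{{_ : NonZero d}} → 1# ≤ L → 1 ℕ.≤ n → IsOpen S → member S ⊆ Cube d (fromℕ n) →
                 ∀ m → (∀ t → hits (allIndices (λ _ → n)) t ℕ.≤ m) →
                 ∃[ t ] (∃[ B ] IsCover S B × IsSum (λ k → volume (B k)) t) × t ≤ fromℕ m * cost 0
    open-cover 1≤L 1≤n S-open S⊆ m hits≤m = proj₁ sums , (B , cover , proj₁ (proj₂ sums)) , proj₂ (proj₂ sums)
      where
      root : Node 0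
      root = record
        { corner  = λ _ → 0#
        ; pending = allIndices (λ _ → n)
        ; budget  = m
        ; hits≤   = λ t _ → hits≤m t
        }

      B : ℕ → Box d
      B = enumerate degenerate (boxLevel root) []

      sums = partialSums-bounded⇒IsSum (λ k → volume (B k)) {fromℕ m * cost 0} λ N → begin
        partialSum (λ k → volume (B k)) N
          ≤⟨ enumerate-sum volume degenerate-volume volume-nonNeg (boxLevel root) [] N ⟩
        0# + partialSum (λ k → Σₗ (boxLevel root k) volume) N
          ≈⟨ +-identityˡ _ ⟩
        partialSum (λ k → Σₗ (boxLevel root k) volume) N
          ≤⟨ boxLevels-sum root N ⟩
        fromℕ m * cost 0 ∎
        where open ≤-Reasoning

      cover : IsCover S B
      cover p p∈S = proj₁ listed-box , ≡.subst (λ b → Interior b p) (≡.sym (proj₂ listed-box)) (proj₂ (proj₂ (proj₂ found)))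
        where
        -- As `1# ≤ L`, the `n` cells of side `L` reach at least up to n. The predecessor of `n` is
        -- passed on because the index found has to be less than `n`.
        marks : ∀ i → ∃[ k ] suc k ℕ.≤ n × mark L k ≤ p i × p i ≤ mark L (suc k)
        marks i = let k , k≤ , between = nearest-mark L (ℕ.pred n) (proj₁ (S⊆ p∈S i)) p≤ in
          k , ≡.subst (suc k ℕ.≤_) 1+pred≡n (s≤s k≤) , between
          where
          open ≤-Reasoning
          1+pred≡n : suc (ℕ.pred n) ≡ n
          1+pred≡n = ℕ.suc-pred n {{ℕ.>-nonZero 1≤n}}
          p≤ : p i ≤ mark L (suc (ℕ.pred n))
          p≤ = begin
            p i                      ≤⟨ proj₂ (S⊆ p∈S i) ⟩
            fromℕ n                  ≈⟨ *-identityʳ _ ⟨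
            fromℕ n * 1#             ≤⟨ *-monoˡ-≤ (fromℕ-nonNeg n) 1≤L ⟩
            mark L n                 ≡⟨ ≡.cong (mark L) 1+pred≡n ⟨
            mark L (suc (ℕ.pred n))  ∎

        listed = allIndices-complete {n = λ _ → n} (λ i → Fin.fromℕ< (proj₁ (proj₂ (marks i))))
        c = proj₁ listed

        c≡ : ∀ i → toℕ (c i) ≡ proj₁ (marks i)
        c≡ i = ≡.trans (≡.cong toℕ (proj₂ (proj₂ listed) i)) (Fin.toℕ-fromℕ< _)

        -- The position of `p` relative to its cell: a point of the root cube whose translate by `c`
        -- is `p`.
        t : Point d
        t i = p i - mark L (toℕ (c i))

        t∈ : InCube (λ _ → 0#) L t
        t∈ i = 0≤- (proj₁ between) ,
               ≤-by (0≤- (proj₂ between)) (solve 3 (λ p k l → 𝟘 :+ l := (p :- k :* l) :+ ((𝟙 :+ k) :* l :- p)) refl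
                 (p i) (fromℕ (toℕ (c i))) L)
          where
          between : mark L (toℕ (c i)) ≤ p i × p i ≤ mark L (suc (toℕ (c i)))
          between = ≡.subst (λ k → mark L k ≤ p i × p i ≤ mark L (suc k)) (≡.sym (c≡ i)) (proj₂ (proj₂ (marks i)))

        small = width-null L (proj₁ (proj₂ (S-open p p∈S)))

        found = descend root (proj₂ (proj₂ (S-open p p∈S))) {proj₁ small} {0} ≡.refl (proj₂ small) (here ≡.refl)
          (proj₁ (proj₂ listed)) t t∈ (λ i → solve 2 (λ p m → (p :- m) :+ m := p) refl _ _)

        listed-box = enumerate-levels degenerate (boxLevel root) [] (proj₁ found) (proj₁ (proj₂ (proj₂ found)))

-- Suprema, infima and maxima with default values, and the choice of the steps s and L.

module Extrema (lem : ∀ {ℓ} → ExcludedMiddle ℓ) (R : CompleteOrderedField) where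

  open CompleteOrderedField R renaming (Carrier to ℝ; setoid to ℝ-setoid)
  open Extremal lem R
  open OrderedField lem R
  open Sums lem R
  open Overlaps lem R
  open Cells lem R
  open Transfer lem R
  open Decomposition lem R

  private variable
    ℓ : Level
    d n : ℕ

  sup-IsSup : {S : Pred ℝ ℓ} → ∃ (IsSup S) → IsSup S (sup S)
  sup-IsSup {S = S} S-sup with lem {P = ∃ (IsSup S)}
  ... | yes (_ , s-sup) = s-sup
  ... | no  none        = ⊥-elim (none S-sup)

  inf-IsInf : {S : Pred ℝ ℓ} → ∃ (IsInf S) → IsInf S (inf S)
  inf-IsInf {S = S} S-inf with lem {P = ∃ (IsInf S)}
  ... | yes (_ , s-inf) = s-inf
  ... | no  none        = ⊥-elim (none S-inf)

  max-IsMax : {S : Pred ℕ ℓ} → ∃ (Bounds.IsMax ℕ._≤_ S) → Bounds.IsMax ℕ._≤_ S (max S)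
  max-IsMax {S = S} S-max with lem {P = ∃ (Bounds.IsMax ℕ._≤_ S)}
  ... | yes (_ , m-max) = m-max
  ... | no  none        = ⊥-elim (none S-max)

  -- Every real bounds the empty set from above, so no bound `s` is least: `s - 1#` is a smaller
  -- one.
  sup-empty : {S : Pred ℝ ℓ} → (∀ x → ¬ S x) → sup S ≡ 0#
  sup-empty {S = S} empty with lem {P = ∃ (IsSup S)}
  ... | no  _                = ≡.refl
  ... | yes (s , _ , s-least) = ⊥-elim (<⇒≱ (<-by 0<1 (solve 1 (λ s → s := (s :- 𝟙) :+ 𝟙) refl s))
                                           (s-least λ {x} x∈S → ⊥-elim (empty x x∈S)))

  max-empty : {S : Pred ℕ ℓ} → (∀ k → ¬ S k) → max S ≡ 0
  max-empty {S = S} empty with lem {P = ∃ (Bounds.IsMax ℕ._≤_ S)}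
  ... | no  _             = ≡.refl
  ... | yes (m , m∈S , _) = ⊥-elim (empty m m∈S)

  -- Excluded middle allows completeness to be applied to predicates of any level.
  bounded⇒IsSup : (S : Pred ℝ ℓ) → ∃ S → ∃ (UpperBound S) → ∃ (IsSup S)
  bounded⇒IsSup S (x , x∈S) (u , S≤u) = proj₁ supremum ,
    (λ y∈S → proj₁ (proj₂ supremum) (dec-true lem y∈S)) ,
    (λ S≤y → proj₂ (proj₂ supremum) (λ y∈ → S≤y (does-true⇒ lem y∈)))
    where
    supremum = complete (λ y → does (lem {P = S y}) ≡ true) (x , dec-true lem x∈S) (u , λ y∈ → S≤u (does-true⇒ lem y∈))

  bounded⇒IsInf : (S : Pred ℝ 0ℓ) → ∃ S → ∃ (LowerBound S) → ∃ (IsInf S)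
  bounded⇒IsInf S (x , x∈S) lower-bound = proj₁ supremum ,
    (λ y∈S → proj₂ (proj₂ supremum) (λ lb → lb y∈S)) , proj₁ (proj₂ supremum)
    where supremum = complete (LowerBound S) lower-bound (x , λ lb → lb x∈S)

  bounded⇒IsMax : (S : Pred ℕ ℓ) → ∃ S → ∀ b → (∀ {k} → k ∈ S → k ℕ.≤ b) → ∃ (Bounds.IsMax ℕ._≤_ S)
  bounded⇒IsMax S (k , k∈S) b S≤b with lem {P = b ∈ S}
  ... | yes b∈S = b , b∈S , S≤b
  ... | no  b∉S = below b S≤b b∉S
    where
    below : ∀ b → (∀ {k} → k ∈ S → k ℕ.≤ b) → ¬ b ∈ S → ∃ (Bounds.IsMax ℕ._≤_ S)
    below zero    S≤b b∉S = ⊥-elim (b∉S (≡.subst S (ℕ.n≤0⇒n≡0 (S≤b k∈S)) k∈S))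
    below (suc b) S≤b b∉S = bounded⇒IsMax S (k , k∈S) b
      λ {j} j∈S → ℕ.≤-pred (ℕ.≤∧≢⇒< (S≤b j∈S) λ { ≡.refl → b∉S j∈S })

  CoverSum : Subset d → Pred ℝ 0ℓ
  CoverSum S t = ∃[ B ] IsCover S B × IsSum (λ k → volume (B k)) t

  partialSum≤IsSum : ∀ a {t} → IsSum a t → ∀ N → partialSum a N ≤ t
  partialSum≤IsSum a t-sum N = proj₁ t-sum (N , refl)

  μ-IsInf : ∀ {S : Subset d} → ∃ (CoverSum S) → IsInf (CoverSum S) (μ S)
  μ-IsInf {S = S} covered = inf-IsInf (bounded⇒IsInf (CoverSum S) covered
    (0# , λ { (B , _ , t-sum) → partialSum≤IsSum (λ k → volume (B k)) t-sum 0 }))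

  -- If no cover had a finite sum, `μ S` would be the default value of `inf`; the first hypothesis
  -- excludes this.
  ≤μ : ∀ {S : Subset d} {x} → ∃ (CoverSum S) →
       (∀ B → IsCover S B → ∃[ N ] x ≤ partialSum (λ k → volume (B k)) N) → x ≤ μ S
  ≤μ {S = S} {x} covered x≤sums = proj₂ (μ-IsInf {S = S} covered) lower-bound
    where
    lower-bound : LowerBound (CoverSum S) x
    lower-bound (B , cover , t-sum) = let N , x≤ = x≤sums B cover in ≤-trans x≤ (partialSum≤IsSum (λ k → volume (B k)) t-sum N)

  -- The list is prescribed before any P, so it may contain entries that no gap can equal; those
  -- that are not positive impose no condition.
  smallStep : ∀ es → ∃[ s ] 0# < s × All (λ e → 0# < e → s ≤ e) es
  smallStep []       = 1# , 0<1 , []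
  smallStep (e ∷ es) with smallStep es | ≤⊎> e 0#
  ... | s , 0<s , s≤ | inj₁ e≤0 = s , 0<s , (λ 0<e → ⊥-elim (<⇒≱ 0<e e≤0)) ∷ s≤
  ... | s , 0<s , s≤ | inj₂ 0<e with total s e
  ... | inj₁ s≤e = s , 0<s , (λ _ → s≤e) ∷ s≤
  ... | inj₂ e≤s = e , 0<e , (λ _ → ≤-refl) ∷ All.map (λ s≤ 0<e → ≤-trans e≤s (s≤ 0<e)) s≤

  smallSteps : ∀ (δ : Fin d → List ℝ) → ∃[ s ] 0# < s × s ≤ 1# × (∀ i → All (λ e → 0# < e → s ≤ e) (δ i))
  smallSteps {d} δ = let s , 0<s , s≤ = positive-lowerBound steps 0<steps in
    s , 0<s , s≤ Fin.zero , λ i → All.map (λ step≤ 0<e → ≤-trans (s≤ (Fin.suc i)) (step≤ 0<e)) (proj₂ (proj₂ (smallStep (δ i))))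
    where
    steps : Fin (suc d) → ℝ
    -- The extra entry gives `s ≤ 1#`, which keeps the cells inside [0,n]ᵈ.
    steps Fin.zero    = 1#
    steps (Fin.suc i) = proj₁ (smallStep (δ i))
    0<steps : ∀ i → 0# < steps i
    0<steps Fin.zero    = 0<1
    0<steps (Fin.suc i) = proj₁ (proj₂ (smallStep (δ i)))

  largeStep : ∀ {b} es → ∃[ L ] b ≤ L × All (_≤ L) es
  largeStep {b} []       = b , ≤-refl , []
  largeStep {b} (e ∷ es) with largeStep {b} es
  ... | L , b≤L , es≤L with total e L
  ... | inj₁ e≤L = L , b≤L , e≤L ∷ es≤L
  ... | inj₂ L≤e = e , ≤-trans b≤L L≤e , ≤-refl ∷ All.map (λ ≤L → ≤-trans ≤L L≤e) es≤L

  largeSteps : ∀ (δ : Fin d → List ℝ) → ∃[ L ] 1# ≤ L × (∀ i → All (_≤ L) (δ i))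
  largeSteps {zero}  δ = 1# , ≤-refl , λ ()
  largeSteps {suc d} δ with largeSteps (δ ∘ Fin.suc)
  ... | L , 1≤L , ≤L with largeStep {L} (δ Fin.zero)
  ... | L′ , L≤L′ , ≤L′ = L′ , ≤-trans 1≤L L≤L′ ,
    λ { Fin.zero → ≤L′ ; (Fin.suc i) → All.map (λ e≤L → ≤-trans e≤L L≤L′) (≤L i) }

  All-Pointwise : ∀ {Q : Pred ℝ 0ℓ} → (∀ {x y} → x ≈ y → Q y → Q x) →
                  ∀ {xs ys} → Pointwise _≈_ xs ys → All Q ys → All Q xs
  All-Pointwise resp-Q []            []       = []
  All-Pointwise resp-Q (x≈y ∷ xs≈ys) (q ∷ qs) = resp-Q x≈y q ∷ All-Pointwise resp-Q xs≈ys qs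

  ∅ : Subset d
  ∅ .member _ = ⊥
  ∅ .resp _ ()

  Attained : ∀ (n : ℕ) {d} {m : Fin d → ℕ} → Matrix m → Pred ℕ 0ℓ
  Attained n {d} M k = ∃[ A ] MatrixFree M A × ones {d} {λ _ → n} A ≡ k

  Measure : ℝ → Subset d → Pred ℝ (lsuc 0ℓ)
  Measure {d} x P t = ∃[ S ] IsOpen S × member S ⊆ Cube d x × Free P S × t ≈ μ S

  -- Empty P.

  module _ (P : Subset d) (fin : Finite P) (none : ∀ {p} → ¬ p ∈ member P) where

    contains-empty : ∀ S → Contains S P
    contains-empty S = (λ i → record { to = λ { (_ , _ , p∈P , _) → ⊥-elim (none p∈P) }
                                     ; cong = λ { {_ , _ , p∈P , _} → ⊥-elim (none p∈P) } }) ,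
      (λ { i (_ , _ , p∈P , _) → ⊥-elim (none p∈P) }) , λ p p∈P → ⊥-elim (none p∈P)

    contains-emptyMatrix : ∀ (A : Matrix {d} (λ _ → n)) → ContainsMatrix A M[ P , fin ]
    contains-emptyMatrix A = (λ i j → absurd i j) , (λ i {j} → absurd i j) , λ x → ⇒-≤ λ Mx → ⊥-elim (none (M-true⇒ P fin Mx))
      where
      absurd : ∀ {ℓ} {X : Set ℓ} i → Fin (length (values P fin i)) → X
      absurd i j = ⊥-elim (none (proj₁ (proj₂ (values-Coord P fin i j))))

    -- No set is free of the empty set, so the supremum is over nothing; its default agrees with
    -- that of the maximum in `ex-empty`.
    opx-empty : ∀ x → opx x P ≡ 0#
    opx-empty x = sup-empty {S = Measure x P} λ { _ (S , _ , _ , free , _) → free (contains-empty S) }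

    ex-empty : ∀ n → ex n M[ P , fin ] ≡ 0
    ex-empty n = max-empty {S = Attained n M[ P , fin ]} λ { _ (A , free , _) → free (contains-emptyMatrix A) }

  -- The two bounds for nonempty P.

  module _ .{{_ : NonZero d}} (P : Subset d) (fin : Finite P) {p₀} (p₀∈P : p₀ ∈ member P)
           {s L} (0<s : 0# < s) (s≤1 : s ≤ 1#) (1≤L : 1# ≤ L)
           (separated : ∀ i → All (λ e → 0# < e → s ≤ e) (gaps P fin i))
           (spread : ∀ i → All (_≤ L) (gaps P fin i)) {n} (1≤n : 1 ℕ.≤ n) where

    private
      0<L : 0# < L
      0<L = <-≤-trans 0<1 1≤L

      C₂ : ℝ
      C₂ = cubeVolume d (triple L)

      M = M[ P , fin ]

    ∅-free : Free P ∅
    ∅-free (_ , _ , f-P) = f-P p₀ p₀∈P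

    ex-IsMax : Bounds.IsMax ℕ._≤_ (Attained n M) (ex n M)
    ex-IsMax = max-IsMax (bounded⇒IsMax (Attained n M)
      -- Sampling the empty set gives the zero matrix, so some free matrix exists; the base point
      -- `p₀` is arbitrary.
      (_ , samples P fin ∅ L p₀ n , samples-free P fin (<⇒≤ 0<L) spread ∅ ∅-free p₀ n , ≡.refl)
      (length (allIndices {d} (λ _ → n)))
      λ { (A , _ , ≡.refl) → length-filter (T? ∘ entry A) (allIndices _) })

    free-cover : ∀ S → IsOpen S → member S ⊆ Cube d (fromℕ n) → Free P S →
                 ∃[ t ] CoverSum S t × t ≤ fromℕ (ex n M) * C₂
    free-cover S S-open S⊆ free = open-cover S 0<L n 1≤L 1≤n S-open S⊆ (ex n M)
      -- The number of hits at `t` is by definition the number of ones of the matrix sampled at `t`.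
      λ t → proj₂ ex-IsMax (samples P fin S L t n , samples-free P fin (<⇒≤ 0<L) spread S free t n , ≡.refl)

    Measure-bound : UpperBound (Measure (fromℕ n) P) (C₂ * fromℕ (ex n M))
    Measure-bound {t} (S , S-open , S⊆ , free , t≈μ) = let u , u-sum , u≤ = free-cover S S-open S⊆ free in begin
      t                     ≈⟨ t≈μ ⟩
      μ S                   ≤⟨ proj₁ (μ-IsInf {S = S} (u , u-sum)) u-sum ⟩
      u                     ≤⟨ u≤ ⟩
      fromℕ (ex n M) * C₂   ≈⟨ *-comm _ _ ⟩
      C₂ * fromℕ (ex n M)   ∎
      where open ≤-Reasoning

    opx-IsSup : IsSup (Measure (fromℕ n) P) (opx (fromℕ n) P)
    opx-IsSup = sup-IsSup {S = Measure (fromℕ n) P} (bounded⇒IsSup (Measure (fromℕ n) P)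
      (μ ∅ , ∅ , (λ _ ()) , (λ ()) , ∅-free , refl) (C₂ * fromℕ (ex n M) , Measure-bound))

    opx≤ex : opx (fromℕ n) P ≤ C₂ * fromℕ (ex n M)
    opx≤ex = proj₂ opx-IsSup Measure-bound

    μ≤opx : ∀ S → IsOpen S → member S ⊆ Cube d (fromℕ n) → Free P S → μ S ≤ opx (fromℕ n) P
    μ≤opx S S-open S⊆ free = proj₁ opx-IsSup {μ S} (S , S-open , S⊆ , free , refl)

    ones≤opx : ∀ (A : Matrix {d} (λ _ → n)) → MatrixFree M A →
               fromℕ (ones A) * cubeVolume d (s * ½) ≤ opx (fromℕ n) P
    ones≤opx A free = ≤-trans
      (≤μ {S = S} (t , covered) (cover-cells 0<s A))
      (μ≤opx S (cells-open 0<s A) S⊆ S-free)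
      where
      S : Subset d
      S = cells 0<s A
      S⊆ : member S ⊆ Cube d (fromℕ n)
      S⊆ {p} = cells⊆Cube 0<s s≤1 A {p}
      S-free : Free P S
      S-free = cells-free P fin 0<s separated A free
      -- The construction for the upper bound supplies the cover of finite volume without which
      -- `μ S` might be a default value.
      S-cover = free-cover S (cells-open 0<s A) (λ {p} → S⊆ {p}) S-free
      t = proj₁ S-cover
      covered : CoverSum S t
      covered = proj₁ (proj₂ S-cover)

    ex≤opx : cubeVolume d (s * ½) * fromℕ (ex n M) ≤ opx (fromℕ n) P
    ex≤opx = let A , free , ones≡ex = proj₁ ex-IsMax in
      ≤-respˡ-≈ (trans (*-comm _ _) (*-congˡ (reflexive (≡.cong fromℕ ones≡ex)))) (ones≤opx A free)

theorem5p11 : (lem : ∀ {ℓ} → ExcludedMiddle ℓ) (R : CompleteOrderedField) →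
    let open CompleteOrderedField R renaming (Carrier to ℝ)
        open Extremal lem R
    in (d : ℕ) .{{_ : NonZero d}} (δ : Fin d → List ℝ) →
       ∃[ C₁ ] ∃[ C₂ ] 0# < C₁ × 0# < C₂ ×
         ((P : Subset d) (fin : Finite P) → (∀ i → Pointwise _≈_ (gaps P fin i) (δ i)) →
           (λ n → opx (fromℕ n) P) ≍[ C₁ , C₂ ] (λ n → fromℕ (ex n M[ P , fin ])))
-- The volumes of a middle half, (s/2)ᵈ, and of the tripled root cube, (3L)ᵈ. Both `s` and `L` are
-- computed from `δ` before `P` is given, so the constants depend on the gaps alone.
theorem5p11 lem R d δ = cubeVolume d (s * ½) , cubeVolume d (triple L) ,
  ∏-pos {d} (λ _ → *½-pos 0<s) , ∏-pos {d} (λ _ → +-pos-nonNeg (+-pos-nonNeg 0<L (<⇒≤ 0<L)) (<⇒≤ 0<L)) ,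
  -- The threshold is 1: both bounds hold for every positive `n`.
  λ P fin gaps≈δ → 1 , λ n 1≤n → bounds P fin gaps≈δ 1≤n
  where
  open CompleteOrderedField R renaming (Carrier to ℝ)
  open Extremal lem R
  open OrderedField lem R
  open Sums lem R
  open Overlaps lem R
  open Decomposition lem R
  open Extrema lem R

  small = smallSteps δ
  large = largeSteps δ
  s = proj₁ small
  L = proj₁ large
  0<s = proj₁ (proj₂ small)
  1≤L = proj₁ (proj₂ large)
  0<L = <-≤-trans 0<1 1≤L

  bounds : (P : Subset d) (fin : Finite P) → (∀ i → Pointwise _≈_ (gaps P fin i) (δ i)) → ∀ {n} → 1 ℕ.≤ n →
           cubeVolume d (s * ½) * fromℕ (ex n M[ P , fin ]) ≤ opx (fromℕ n) P ×
           opx (fromℕ n) P ≤ cubeVolume d (triple L) * fromℕ (ex n M[ P , fin ])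
  bounds P fin gaps≈δ {n} 1≤n = cases lem
    where
    separated = λ i → All-Pointwise (λ x≈y s≤y 0<x → ≤-respʳ-≈ (sym x≈y) (s≤y (<-respʳ-≈ x≈y 0<x)))
                        (gaps≈δ i) (proj₂ (proj₂ (proj₂ small)) i)
    spread = λ i → All-Pointwise (λ x≈y → ≤-respˡ-≈ (sym x≈y)) (gaps≈δ i) (proj₂ (proj₂ large) i)

    cases : Dec (∃ (member P)) → _
    cases (yes (p , p∈P)) = ex≤opx P fin p∈P 0<s s≤1 1≤L separated spread 1≤n ,
                            opx≤ex P fin p∈P 0<s s≤1 1≤L separated spread 1≤n
      where s≤1 = proj₁ (proj₂ (proj₂ small))
    cases (no  none) = ≤-reflexive (trans (vanish _) (sym opx≈0)) , ≤-reflexive (trans opx≈0 (sym (vanish _)))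
      where
      empty : ∀ {p} → ¬ p ∈ member P
      empty p∈P = none (_ , p∈P)
      opx≈0 = reflexive (opx-empty P fin empty (fromℕ n))
      vanish : ∀ C → C * fromℕ (ex n M[ P , fin ]) ≈ 0#
      vanish C = trans (*-congˡ (reflexive (≡.cong fromℕ (ex-empty P fin empty n)))) (zeroʳ C)
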